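{- For every $r\ge0$ and every partition $\lambda$, $$C_r^{(\alpha)}(\lambda)=\frac{\alpha^r}{r+1}\sum_{i\ge1}\Bigl[B_{r+1}\bigl(A_i(\lambda)\bigr)-B_{r+1}\bigl(A_i(0)\bigr)\Bigr].$$ In particular, the content moments $C_r^{(\alpha)}$ belong to the (shifted-symmetric) algebra of functions on partitions generated by the functions $q_s$, $s\ge 2$.
   Context: Let $\alpha$ be an indeterminate and $\theta=\alpha^{ -1}$; functions on partitions take values in $\mathbb Q(\alpha)$. For a box $\square=(i,j)$ (row $i$, column $j$), $c_\alpha(\square)=\alpha(j-1)-(i-1)$, and $C_r^{(\alpha)}(\lambda)=\sum_{\square\in\lambda}c_\alpha(\square)^r$. The shifted row coordinates are $A_i(\lambda)=\lambda_i-\theta(i-1)$ and $A_i(0)=-\theta(i-1)$. The Bernoulli polynomials $B_m(x)$ are defined by $\frac{ue^{xu}}{e^u-1}=\sum_{m\ge0}B_m(x)\frac{u^m}{m!}$. The functions $q_s$ are $$q_s(\lambda)=\sum_{i\ge1}\bigl[A_i(\lambda)^s-(A_i(\lambda)-\theta)^s-A_i(0)^s+(A_i(0)-\theta)^s\bigr].$$ (All sums over $i$ are finite, since terms with $i>\ell(\lambda)$ vanish.) -}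

module Defs where

open import Algebra.Bundles using (CommutativeRing)
open import Algebra.Definitions using (AlmostLeftCancellative)
import Algebra.Properties.Group as GroupProperties
import Algebra.Properties.Monoid.Mult as MonoidMult
import Algebra.Properties.Monoid.Sum as MonoidSum
import Algebra.Properties.Ring as RingProperties
import Algebra.Properties.Semiring.Exp as SemiringExp
import Algebra.Solver.Ring.NaturalCoefficients.Default as SemiringSolver
open import Algebra.Structures using (IsCommutativeRing)
open import Data.Empty using (⊥-elim)
open import Data.Fin.Base using (Fin; toℕ)
open import Data.Integer.Base using (+_)
open import Data.List.Base using (List; []; _∷_; length)
open import Data.List.Relation.Unary.All using (All)
open import Data.List.Relation.Unary.Linked using (Linked)
open import Data.Nat.Base as ℕ using (ℕ; zero; suc; _∸_; _!; _≤_; _≥_; _>_; z≤n; s≤s)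
import Data.Nat.Properties as ℕ
open import Data.Product.Base using (∃; _,_; proj₁)
open import Data.Rational.Base as ℚ using (ℚ; 0ℚ; 1ℚ)
import Data.Rational.Properties as ℚ
import Data.Rational.Unnormalised.Base as ℚᵘ
import Data.Rational.Unnormalised.Properties as ℚᵘ
open import Level using (0ℓ; _⊔_)
open import Relation.Binary.Definitions using (Decidable)
open import Relation.Binary.PropositionalEquality.Core as ≡ using (_≡_; _≢_)
import Relation.Binary.PropositionalEquality
import Relation.Binary.Reasoning.Setoid as SetoidReasoning
open import Relation.Nullary using (¬_; yes; no)

module PowerSeries {c ℓ} (R : CommutativeRing c ℓ) where

  open CommutativeRing R
  open RingProperties ring using (-‿distribˡ-*)
  open MonoidSum +-monoid using (sum; sum-cong-≋; sum⁺-syntax)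
  open SetoidReasoning setoid

  infix  4 _≈ˢ_
  infix  8 -ˢ_
  infixl 7 _*ˢ_
  infixl 6 _+ˢ_

  Series : Set c
  Series = ℕ → Carrier

  _≈ˢ_ : Series → Series → Set ℓ
  f ≈ˢ g = ∀ n → f n ≈ g n

  _+ˢ_ _*ˢ_ : Series → Series → Series
  (f +ˢ g) n = f n + g n
  (f *ˢ g) n = ∑[ k ≤ n ] (f (toℕ k) * g (n ∸ toℕ k))

  -ˢ_ : Series → Series
  (-ˢ f) n = - f n

  constantˢ : Carrier → Series
  constantˢ a zero    = a
  constantˢ a (suc _) = 0#

  0ˢ 1ˢ u : Series
  0ˢ _ = 0#
  1ˢ   = constantˢ 1#
  u zero    = 0#
  u (suc n) = 1ˢ n

  tail : Series → Series
  tail f n = f (suc n)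

  -- Long division: if g = f * h and f has constant term 1, then h has constant
  -- term g 0 and tail g - g 0 · tail f = f * tail h.
  divide : Series → Series → Series
  divide g f zero    = g 0
  divide g f (suc n) = divide (λ k → g (suc k) - g 0 * f (suc k)) f n

  *ˢ-cong : ∀ {f f′ g g′} → f ≈ˢ f′ → g ≈ˢ g′ → f *ˢ g ≈ˢ f′ *ˢ g′
  *ˢ-cong p q n = sum-cong-≋ {suc n} (λ k → *-cong (p (toℕ k)) (q (n ∸ toℕ k)))

  private
    interchange : ∀ a b x y → (a + b) + (x + y) ≈ (a + x) + (b + y)
    interchange = solve 4 (λ a b x y → (a :+ b) :+ (x :+ y) := (a :+ x) :+ (b :+ y)) refl
      where open SemiringSolver commutativeSemiring

  *ˢ-distribʳ : ∀ h f g → (f +ˢ g) *ˢ h ≈ˢ (f *ˢ h) +ˢ (g *ˢ h)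
  *ˢ-distribʳ h f g zero = begin
    (f 0 + g 0) * h 0 + 0#                ≈⟨ +-cong (distribʳ _ _ _) (sym (+-identityˡ 0#)) ⟩
    (f 0 * h 0 + g 0 * h 0) + (0# + 0#)   ≈⟨ interchange _ _ _ _ ⟩
    (f 0 * h 0 + 0#) + (g 0 * h 0 + 0#)   ∎
  *ˢ-distribʳ h f g (suc n) = begin
    (f 0 + g 0) * h (suc n) + ((tail f +ˢ tail g) *ˢ h) n
      ≈⟨ +-cong (distribʳ _ _ _) (*ˢ-distribʳ h (tail f) (tail g) n) ⟩
    (f 0 * h (suc n) + g 0 * h (suc n)) + ((tail f *ˢ h) n + (tail g *ˢ h) n)
      ≈⟨ interchange _ _ _ _ ⟩
    (f *ˢ h) (suc n) + (g *ˢ h) (suc n) ∎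

  scaleˡ : ∀ a f g n → ((λ k → a * f k) *ˢ g) n ≈ a * (f *ˢ g) n
  scaleˡ a f g zero = begin
    (a * f 0) * g 0 + 0#       ≈⟨ +-identityʳ _ ⟩
    (a * f 0) * g 0            ≈⟨ *-assoc _ _ _ ⟩
    a * (f 0 * g 0)            ≈⟨ *-congˡ (sym (+-identityʳ _)) ⟩
    a * (f 0 * g 0 + 0#)       ∎
  scaleˡ a f g (suc n) = begin
    (a * f 0) * g (suc n) + ((λ k → a * f (suc k)) *ˢ g) n
      ≈⟨ +-cong (*-assoc _ _ _) (scaleˡ a (tail f) g n) ⟩
    a * (f 0 * g (suc n)) + a * (tail f *ˢ g) n
      ≈⟨ sym (distribˡ _ _ _) ⟩
    a * (f *ˢ g) (suc n) ∎

  *ˢ-assoc : ∀ f g h → (f *ˢ g) *ˢ h ≈ˢ f *ˢ (g *ˢ h)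
  *ˢ-assoc f g h zero = +-congʳ (begin
    (f 0 * g 0 + 0#) * h 0   ≈⟨ *-congʳ (+-identityʳ _) ⟩
    (f 0 * g 0) * h 0        ≈⟨ *-assoc _ _ _ ⟩
    f 0 * (g 0 * h 0)        ≈⟨ *-congˡ (sym (+-identityʳ _)) ⟩
    f 0 * (g 0 * h 0 + 0#)   ∎)
  *ˢ-assoc f g h (suc n) = begin
    (f 0 * g 0 + 0#) * h (suc n) + (((λ k → f 0 * g (suc k)) +ˢ (tail f *ˢ g)) *ˢ h) n
      ≈⟨ +-cong (trans (*-congʳ (+-identityʳ _)) (*-assoc _ _ _))
                (trans (*ˢ-distribʳ h (λ k → f 0 * g (suc k)) (tail f *ˢ g) n)
                       (+-cong (scaleˡ (f 0) (tail g) h n) (*ˢ-assoc (tail f) g h n))) ⟩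
    f 0 * (g 0 * h (suc n)) + (f 0 * (tail g *ˢ h) n + (tail f *ˢ (g *ˢ h)) n)
      ≈⟨ sym (+-assoc _ _ _) ⟩
    (f 0 * (g 0 * h (suc n)) + f 0 * (tail g *ˢ h) n) + (tail f *ˢ (g *ˢ h)) n
      ≈⟨ +-congʳ (sym (distribˡ _ _ _)) ⟩
    (f *ˢ (g *ˢ h)) (suc n) ∎

  *ˢ-sucʳ : ∀ f g n → (f *ˢ g) (suc n) ≈ (f *ˢ tail g) n + f (suc n) * g 0
  *ˢ-sucʳ f g zero = begin
    f 0 * g 1 + (f 1 * g 0 + 0#)   ≈⟨ +-cong (sym (+-identityʳ _)) (+-identityʳ _) ⟩
    (f 0 * g 1 + 0#) + f 1 * g 0   ∎
  *ˢ-sucʳ f g (suc n) = begin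
    f 0 * g (suc (suc n)) + (tail f *ˢ g) (suc n)
      ≈⟨ +-congˡ (*ˢ-sucʳ (tail f) g n) ⟩
    f 0 * g (suc (suc n)) + ((tail f *ˢ tail g) n + f (suc (suc n)) * g 0)
      ≈⟨ sym (+-assoc _ _ _) ⟩
    (f *ˢ tail g) (suc n) + f (suc (suc n)) * g 0 ∎

  *ˢ-comm : ∀ f g → f *ˢ g ≈ˢ g *ˢ f
  *ˢ-comm f g zero    = +-congʳ (*-comm _ _)
  *ˢ-comm f g (suc n) = begin
    f 0 * g (suc n) + (tail f *ˢ g) n   ≈⟨ +-cong (*-comm _ _) (*ˢ-comm (tail f) g n) ⟩
    g (suc n) * f 0 + (g *ˢ tail f) n   ≈⟨ +-comm _ _ ⟩
    (g *ˢ tail f) n + g (suc n) * f 0   ≈⟨ sym (*ˢ-sucʳ g f n) ⟩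
    (g *ˢ f) (suc n)                    ∎

  *ˢ-zeroˡ : ∀ f → 0ˢ *ˢ f ≈ˢ 0ˢ
  *ˢ-zeroˡ f zero    = trans (+-identityʳ _) (zeroˡ _)
  *ˢ-zeroˡ f (suc n) = trans (+-cong (zeroˡ _) (*ˢ-zeroˡ f n)) (+-identityˡ _)

  constantˢ-*ˢ : ∀ a f n → (constantˢ a *ˢ f) n ≈ a * f n
  constantˢ-*ˢ a f zero    = +-identityʳ _
  constantˢ-*ˢ a f (suc n) = trans (+-congˡ (*ˢ-zeroˡ f n)) (+-identityʳ _)

  *ˢ-identityˡ : ∀ f → 1ˢ *ˢ f ≈ˢ f
  *ˢ-identityˡ f n = trans (constantˢ-*ˢ 1# f n) (*-identityˡ _)

  isCommutativeRingˢ : IsCommutativeRing _≈ˢ_ _+ˢ_ _*ˢ_ -ˢ_ 0ˢ 1ˢ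
  isCommutativeRingˢ = record
    { isRing = record
      { +-isAbelianGroup = record
        { isGroup = record
          { isMonoid = record
            { isSemigroup = record
              { isMagma = record
                { isEquivalence = record
                  { refl  = λ _ → refl
                  ; sym   = λ p n → sym (p n)
                  ; trans = λ p q n → trans (p n) (q n)
                  }
                ; ∙-cong = λ p q n → +-cong (p n) (q n)
                }
              ; assoc = λ f g h n → +-assoc _ _ _
              }
            ; identity = (λ f n → +-identityˡ _) , (λ f n → +-identityʳ _)
            }
          ; inverse = (λ f n → -‿inverseˡ _) , (λ f n → -‿inverseʳ _)
          ; ⁻¹-cong = λ p n → -‿cong (p n)
          }
        ; comm = λ f g n → +-comm _ _
        }
      ; *-cong = *ˢ-cong
      ; *-assoc = *ˢ-assoc
      ; *-identity = *ˢ-identityˡ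
                   , (λ f n → trans (*ˢ-comm f 1ˢ n) (*ˢ-identityˡ f n))
      ; distrib = (λ f g h n → trans (*ˢ-comm f (g +ˢ h) n)
                     (trans (*ˢ-distribʳ f g h n)
                            (+-cong (*ˢ-comm g f n) (*ˢ-comm h f n))))
                , *ˢ-distribʳ
      }
    ; *-comm = *ˢ-comm
    }

  divide-correct : ∀ g f → f 0 ≈ 1# → f *ˢ divide g f ≈ˢ g
  divide-correct g f f₀≈1 zero = begin
    f 0 * g 0 + 0#   ≈⟨ +-identityʳ _ ⟩
    f 0 * g 0        ≈⟨ *-congʳ f₀≈1 ⟩
    1# * g 0         ≈⟨ *-identityˡ _ ⟩
    g 0              ∎
  divide-correct g f f₀≈1 (suc n) = begin
    (f *ˢ divide g f) (suc n)
      ≈⟨ *ˢ-sucʳ f (divide g f) n ⟩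
    (f *ˢ divide (λ k → g (suc k) - g 0 * f (suc k)) f) n + f (suc n) * g 0
      ≈⟨ +-cong (divide-correct _ f f₀≈1 n) (*-comm _ _) ⟩
    (g (suc n) - g 0 * f (suc n)) + g 0 * f (suc n)
      ≈⟨ +-assoc _ _ _ ⟩
    g (suc n) + (- (g 0 * f (suc n)) + g 0 * f (suc n))
      ≈⟨ +-congˡ (-‿inverseˡ _) ⟩
    g (suc n) + 0#
      ≈⟨ +-identityʳ _ ⟩
    g (suc n) ∎

  divide-shifted : ∀ f g → f 0 ≈ 0# → f 1 ≈ 1# → f *ˢ divide g (tail f) ≈ˢ u *ˢ g
  divide-shifted f g f₀≈0 f₁≈1 zero    =
    +-congʳ (trans (trans (*-congʳ f₀≈0) (zeroˡ _)) (sym (zeroˡ _)))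
  divide-shifted f g f₀≈0 f₁≈1 (suc n) = +-cong
    (trans (trans (*-congʳ f₀≈0) (zeroˡ _)) (sym (zeroˡ _)))
    (trans (divide-correct g (tail f) f₁≈1 n) (sym (*ˢ-identityˡ g n)))

  module _ (_≟_ : Decidable _≈_) (cancel : AlmostLeftCancellative _≈_ 0# _*_) where

    private
      no-zero-divisors : ∀ {x y} → ¬ x ≈ 0# → x * y ≈ 0# → y ≈ 0#
      no-zero-divisors x≉0 xy≈0 = cancel _ _ _ x≉0 (trans xy≈0 (sym (zeroʳ _)))

      drop₀ : ∀ f g → g 0 ≈ 0# → f *ˢ g ≈ˢ 0ˢ → f *ˢ tail g ≈ˢ 0ˢ
      drop₀ f g g₀≈0 fg≈0 n = begin
        (f *ˢ tail g) n                     ≈⟨ sym (+-identityʳ _) ⟩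
        (f *ˢ tail g) n + 0#                ≈⟨ +-congˡ (sym (trans (*-congˡ g₀≈0) (zeroʳ _))) ⟩
        (f *ˢ tail g) n + f (suc n) * g 0   ≈⟨ sym (*ˢ-sucʳ f g n) ⟩
        (f *ˢ g) (suc n)                    ≈⟨ fg≈0 (suc n) ⟩
        0#                                  ∎

      unit-case : ∀ f g → ¬ f 0 ≈ 0# → f *ˢ g ≈ˢ 0ˢ → g ≈ˢ 0ˢ
      unit-case f g f₀≉0 fg≈0 n = go n
        where
        g₀≈0 : g 0 ≈ 0#
        g₀≈0 = no-zero-divisors f₀≉0 (trans (sym (+-identityʳ _)) (fg≈0 0))
        go : g ≈ˢ 0ˢ
        go zero    = g₀≈0
        go (suc m) = unit-case f (tail g) f₀≉0 (drop₀ f g g₀≈0 fg≈0) m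

      nonzero-case : ∀ f g n → ¬ g n ≈ 0# → f *ˢ g ≈ˢ 0ˢ → f ≈ˢ 0ˢ
      nonzero-case f g n gₙ≉0 fg≈0 with g 0 ≟ 0#
      ... | no g₀≉0 = unit-case g f g₀≉0 (λ m → trans (*ˢ-comm g f m) (fg≈0 m))
      nonzero-case f g zero    gₙ≉0 fg≈0 | yes g₀≈0 = ⊥-elim (gₙ≉0 g₀≈0)
      nonzero-case f g (suc n) gₙ≉0 fg≈0 | yes g₀≈0 =
        nonzero-case f (tail g) n gₙ≉0 (drop₀ f g g₀≈0 fg≈0)

    *ˢ-cancelˡ : AlmostLeftCancellative _≈ˢ_ 0ˢ _*ˢ_
    *ˢ-cancelˡ f g h f≉0 fg≈fh n with (g n - h n) ≟ 0#
    ... | yes p = GroupProperties.x∙y⁻¹≈ε⇒x≈y +-group _ _ p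
    ... | no ¬p = ⊥-elim (f≉0 (nonzero-case f (g +ˢ (-ˢ h)) n ¬p f[g-h]≈0))
      where
      open IsCommutativeRing isCommutativeRingˢ using () renaming (distribˡ to distribˡˢ)
      f[g-h]≈0 : f *ˢ (g +ˢ (-ˢ h)) ≈ˢ 0ˢ
      f[g-h]≈0 m = begin
        (f *ˢ (g +ˢ (-ˢ h))) m            ≈⟨ distribˡˢ f g (-ˢ h) m ⟩
        (f *ˢ g) m + (f *ˢ (-ˢ h)) m      ≈⟨ +-congʳ (fg≈fh m) ⟩
        (f *ˢ h) m + (f *ˢ (-ˢ h)) m      ≈⟨ sym (distribˡˢ f h (-ˢ h) m) ⟩
        (f *ˢ (h +ˢ (-ˢ h))) m            ≈⟨ *ˢ-cong {f} {f} (λ _ → refl) (λ k → -‿inverseʳ (h k)) m ⟩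
        (f *ˢ 0ˢ) m                       ≈⟨ *ˢ-comm f 0ˢ m ⟩
        (0ˢ *ˢ f) m                       ≈⟨ *ˢ-zeroˡ f m ⟩
        0#                                ∎

-- Polynomials are power series that vanish from some index on.
module Polynomials {c ℓ} (R : CommutativeRing c ℓ) where

  open CommutativeRing R
  open PowerSeries R
  open MonoidSum +-monoid using (sum; sum-cong-≋; sum-replicate-zero)
  open RingProperties ring using (-0#≈0#)

  -- bound need not be optimal, and equality of polynomials ignores it.
  record Polynomial : Set (c ⊔ ℓ) where
    no-eta-equality  -- together with copatterns, keeps _+ᵖ_ etc. from unfolding in unification
    field
      coeff  : Series
      bound  : ℕ
      vanish : ∀ n → bound ≤ n → coeff n ≈ 0#
  open Polynomial public

  constant : Carrier → Polynomial
  coeff  (constant a) = constantˢ a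
  bound  (constant a) = 1
  vanish (constant a) (suc n) _ = refl

  X : Polynomial
  coeff  X = u
  bound  X = 2
  vanish X (suc (suc n)) _ = refl
  vanish X (suc zero) (s≤s ())

  private
    *-vanish : ∀ p q n → bound p ℕ.+ bound q ≤ n → (coeff p *ˢ coeff q) n ≈ 0#
    *-vanish p q n b≤n = trans (sum-cong-≋ {suc n} term) (sum-replicate-zero (suc n))
      where
      term : ∀ (k : Fin (suc n)) → coeff p (toℕ k) * coeff q (n ∸ toℕ k) ≈ 0#
      term k with bound p ℕ.≤? toℕ k
      ... | yes bp≤k = trans (*-congʳ (vanish p _ bp≤k)) (zeroˡ _)
      ... | no  bp≰k = trans (*-congˡ (vanish q _ bq≤n∸k)) (zeroʳ _)
        where
        bq≤n∸k : bound q ≤ n ∸ toℕ k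
        bq≤n∸k = ℕ.≤-trans
          (ℕ.≤-reflexive (≡.sym (ℕ.m+n∸m≡n (bound p) (bound q))))
          (ℕ.∸-mono b≤n (ℕ.<⇒≤ (ℕ.≰⇒> bp≰k)))

  infix  4 _≈ᵖ_
  infix  8 -ᵖ_
  infixl 7 _*ᵖ_
  infixl 6 _+ᵖ_

  record _≈ᵖ_ (p q : Polynomial) : Set ℓ where
    constructor coefficientwise
    field coeff-≈ : coeff p ≈ˢ coeff q
  open _≈ᵖ_ public

  _+ᵖ_ _*ᵖ_ : Polynomial → Polynomial → Polynomial
  coeff  (p +ᵖ q) = coeff p +ˢ coeff q
  bound  (p +ᵖ q) = bound p ℕ.⊔ bound q
  vanish (p +ᵖ q) n b≤n = trans
    (+-cong (vanish p n (ℕ.≤-trans (ℕ.m≤m⊔n (bound p) (bound q)) b≤n))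
            (vanish q n (ℕ.≤-trans (ℕ.m≤n⊔m (bound p) (bound q)) b≤n)))
    (+-identityˡ _)
  coeff  (p *ᵖ q) = coeff p *ˢ coeff q
  bound  (p *ᵖ q) = bound p ℕ.+ bound q
  vanish (p *ᵖ q) = *-vanish p q

  -ᵖ_ : Polynomial → Polynomial
  coeff  (-ᵖ p) = -ˢ coeff p
  bound  (-ᵖ p) = bound p
  vanish (-ᵖ p) n b≤n = trans (-‿cong (vanish p n b≤n)) -0#≈0#

  0ᵖ : Polynomial
  coeff  0ᵖ = 0ˢ
  bound  0ᵖ = 0
  vanish 0ᵖ _ _ = refl

  polynomialRing : CommutativeRing (c ⊔ ℓ) ℓ
  polynomialRing = record
    { Carrier = Polynomial
    ; _≈_ = _≈ᵖ_
    ; _+_ = _+ᵖ_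
    ; _*_ = _*ᵖ_
    ; -_  = -ᵖ_
    ; 0#  = 0ᵖ
    ; 1#  = constant 1#
    ; isCommutativeRing = record
      { isRing = record
        { +-isAbelianGroup = record
          { isGroup = record
            { isMonoid = record
              { isSemigroup = record
                { isMagma = record
                  { isEquivalence = record
                    { refl  = coefficientwise S.refl
                    ; sym   = λ p → coefficientwise (S.sym (coeff-≈ p))
                    ; trans = λ p q → coefficientwise (S.trans (coeff-≈ p) (coeff-≈ q))
                    }
                  ; ∙-cong = λ p q → coefficientwise (S.+-cong (coeff-≈ p) (coeff-≈ q))
                  }
                ; assoc = λ p q r → coefficientwise (S.+-assoc (coeff p) (coeff q) (coeff r))
                }
              ; identity = (λ p → coefficientwise (S.+-identityˡ (coeff p)))
                         , (λ p → coefficientwise (S.+-identityʳ (coeff p)))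
              }
            ; inverse = (λ p → coefficientwise (S.-‿inverseˡ (coeff p)))
                      , (λ p → coefficientwise (S.-‿inverseʳ (coeff p)))
            ; ⁻¹-cong = λ p → coefficientwise (S.-‿cong (coeff-≈ p))
            }
          ; comm = λ p q → coefficientwise (S.+-comm (coeff p) (coeff q))
          }
        ; *-cong = λ p q → coefficientwise (S.*-cong (coeff-≈ p) (coeff-≈ q))
        ; *-assoc = λ p q r → coefficientwise (S.*-assoc (coeff p) (coeff q) (coeff r))
        ; *-identity = (λ p → coefficientwise (S.*-identityˡ (coeff p)))
                     , (λ p → coefficientwise (S.*-identityʳ (coeff p)))
        ; distrib = (λ p q r → coefficientwise (S.distribˡ (coeff p) (coeff q) (coeff r)))
                  , (λ p q r → coefficientwise (S.distribʳ (coeff p) (coeff q) (coeff r)))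
        }
      ; *-comm = λ p q → coefficientwise (S.*-comm (coeff p) (coeff q))
      }
    }
    where module S = IsCommutativeRing isCommutativeRingˢ

module Fractions {c ℓ} (R : CommutativeRing c ℓ)
  (1≉0 : ¬ CommutativeRing._≈_ R (CommutativeRing.1# R) (CommutativeRing.0# R))
  (cancel : AlmostLeftCancellative (CommutativeRing._≈_ R) (CommutativeRing.0# R)
              (CommutativeRing._*_ R)) where

  open CommutativeRing R
  open SemiringSolver commutativeSemiring
  open RingProperties ring using (-‿distribˡ-*)
  open SetoidReasoning setoid

  record Fraction : Set (c ⊔ ℓ) where
    no-eta-equality
    field
      num   : Carrier
      den   : Carrier
      den≉0 : ¬ den ≈ 0#
  open Fraction public

  infix  4 _≈ᶠ_
  infix  8 -ᶠ_
  infixl 7 _*ᶠ_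
  infixl 6 _+ᶠ_

  record _≈ᶠ_ (x y : Fraction) : Set ℓ where
    constructor cross
    field cross-≈ : num x * den y ≈ num y * den x
  open _≈ᶠ_ public

  embed : Carrier → Fraction
  num   (embed a) = a
  den   (embed a) = 1#
  den≉0 (embed a) = 1≉0

  private
    *-nonzero : ∀ {a b} → ¬ a ≈ 0# → ¬ b ≈ 0# → ¬ a * b ≈ 0#
    *-nonzero a≉0 b≉0 ab≈0 = b≉0 (cancel _ _ _ a≉0 (trans ab≈0 (sym (zeroʳ _))))

  _+ᶠ_ _*ᶠ_ : Fraction → Fraction → Fraction
  num   (x +ᶠ y) = num x * den y + num y * den x
  den   (x +ᶠ y) = den x * den y
  den≉0 (x +ᶠ y) = *-nonzero (den≉0 x) (den≉0 y)
  num   (x *ᶠ y) = num x * num y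
  den   (x *ᶠ y) = den x * den y
  den≉0 (x *ᶠ y) = *-nonzero (den≉0 x) (den≉0 y)

  -ᶠ_ : Fraction → Fraction
  num   (-ᶠ x) = - num x
  den   (-ᶠ x) = den x
  den≉0 (-ᶠ x) = den≉0 x

  private
    ≈ᶠ-trans : ∀ {x y z} → x ≈ᶠ y → y ≈ᶠ z → x ≈ᶠ z
    ≈ᶠ-trans {x} {y} {z} (cross p) (cross q) = cross (cancel (den y) _ _ (den≉0 y) (begin
      den y * (num x * den z)   ≈⟨ solve 3 (λ a d f → d :* (a :* f) := (a :* d) :* f) refl _ _ _ ⟩
      (num x * den y) * den z   ≈⟨ *-congʳ p ⟩
      (num y * den x) * den z   ≈⟨ solve 3 (λ c b f → (c :* b) :* f := (c :* f) :* b) refl _ _ _ ⟩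
      (num y * den z) * den x   ≈⟨ *-congʳ q ⟩
      (num z * den y) * den x   ≈⟨ solve 3 (λ e d b → (e :* d) :* b := d :* (e :* b)) refl _ _ _ ⟩
      den y * (num z * den x)   ∎))

    +ᶠ-cong : ∀ {x x′ y y′} → x ≈ᶠ x′ → y ≈ᶠ y′ → x +ᶠ y ≈ᶠ x′ +ᶠ y′
    +ᶠ-cong {x} {x′} {y} {y′} (cross p) (cross q) = cross (begin
      (num x * den y + num y * den x) * (den x′ * den y′)
        ≈⟨ solve 6 (λ a b c d b′ d′ → (a :* d :+ c :* b) :* (b′ :* d′)
                      := (a :* b′) :* (d :* d′) :+ (c :* d′) :* (b :* b′)) refl _ _ _ _ _ _ ⟩
      (num x * den x′) * (den y * den y′) + (num y * den y′) * (den x * den x′)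
        ≈⟨ +-cong (*-congʳ p) (*-congʳ q) ⟩
      (num x′ * den x) * (den y * den y′) + (num y′ * den y) * (den x * den x′)
        ≈⟨ solve 6 (λ a′ b c′ d b′ d′ → (a′ :* b) :* (d :* d′) :+ (c′ :* d) :* (b :* b′)
                      := (a′ :* d′ :+ c′ :* b′) :* (b :* d)) refl _ _ _ _ _ _ ⟩
      (num x′ * den y′ + num y′ * den x′) * (den x * den y) ∎)

    *ᶠ-cong : ∀ {x x′ y y′} → x ≈ᶠ x′ → y ≈ᶠ y′ → x *ᶠ y ≈ᶠ x′ *ᶠ y′
    *ᶠ-cong {x} {x′} {y} {y′} (cross p) (cross q) = cross (begin
      (num x * num y) * (den x′ * den y′)   ≈⟨ shuffle _ _ _ _ ⟩
      (num x * den x′) * (num y * den y′)   ≈⟨ *-cong p q ⟩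
      (num x′ * den x) * (num y′ * den y)   ≈⟨ shuffle _ _ _ _ ⟩
      (num x′ * num y′) * (den x * den y)   ∎)
      where
      shuffle : ∀ x y z w → (x * y) * (z * w) ≈ (x * z) * (y * w)
      shuffle = solve 4 (λ x y z w → (x :* y) :* (z :* w) := (x :* z) :* (y :* w)) refl

    -ᶠ-cong : ∀ {x y} → x ≈ᶠ y → -ᶠ x ≈ᶠ -ᶠ y
    -ᶠ-cong (cross p) =
      cross (trans (sym (-‿distribˡ-* _ _)) (trans (-‿cong p) (-‿distribˡ-* _ _)))

    +ᶠ-assoc : ∀ x y z → (x +ᶠ y) +ᶠ z ≈ᶠ x +ᶠ (y +ᶠ z)
    +ᶠ-assoc x y z = cross (solve 6 (λ a b c d e f →
      ((a :* d :+ c :* b) :* f :+ e :* (b :* d)) :* (b :* (d :* f)) :=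
      (a :* (d :* f) :+ (c :* f :+ e :* d) :* b) :* ((b :* d) :* f))
      refl (num x) (den x) (num y) (den y) (num z) (den z))

    +ᶠ-comm : ∀ x y → x +ᶠ y ≈ᶠ y +ᶠ x
    +ᶠ-comm x y = cross (solve 4 (λ a b c d →
      (a :* d :+ c :* b) :* (d :* b) := (c :* b :+ a :* d) :* (b :* d))
      refl (num x) (den x) (num y) (den y))

    +ᶠ-identityˡ : ∀ x → embed 0# +ᶠ x ≈ᶠ x
    +ᶠ-identityˡ x = cross (*-cong
      (trans (+-cong (zeroˡ _) (*-identityʳ _)) (+-identityˡ _)) (sym (*-identityˡ _)))

    -ᶠ-inverseˡ : ∀ x → (-ᶠ x) +ᶠ x ≈ᶠ embed 0#
    -ᶠ-inverseˡ x = cross (begin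
      (- num x * den x + num x * den x) * 1#   ≈⟨ *-congʳ (sym (distribʳ _ _ _)) ⟩
      ((- num x + num x) * den x) * 1#         ≈⟨ *-congʳ (*-congʳ (-‿inverseˡ _)) ⟩
      (0# * den x) * 1#                        ≈⟨ *-congʳ (zeroˡ _) ⟩
      0# * 1#                                  ≈⟨ zeroˡ _ ⟩
      0#                                       ≈⟨ sym (zeroˡ _) ⟩
      0# * (den x * den x)                     ∎)

    *ᶠ-assoc : ∀ x y z → (x *ᶠ y) *ᶠ z ≈ᶠ x *ᶠ (y *ᶠ z)
    *ᶠ-assoc x y z = cross (*-cong (*-assoc _ _ _) (sym (*-assoc _ _ _)))

    *ᶠ-comm : ∀ x y → x *ᶠ y ≈ᶠ y *ᶠ x
    *ᶠ-comm x y = cross (*-cong (*-comm _ _) (*-comm _ _))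

    *ᶠ-identityˡ : ∀ x → embed 1# *ᶠ x ≈ᶠ x
    *ᶠ-identityˡ x = cross (*-cong (*-identityˡ _) (sym (*-identityˡ _)))

    *ᶠ-distribʳ : ∀ x y z → (y +ᶠ z) *ᶠ x ≈ᶠ (y *ᶠ x) +ᶠ (z *ᶠ x)
    *ᶠ-distribʳ x y z = cross (solve 6 (λ a b c d e f →
      ((c :* f :+ e :* d) :* a) :* ((d :* b) :* (f :* b)) :=
      ((c :* a) :* (f :* b) :+ (e :* a) :* (d :* b)) :* ((d :* f) :* b))
      refl (num x) (den x) (num y) (den y) (num z) (den z))

  fractionRing : CommutativeRing (c ⊔ ℓ) ℓ
  fractionRing = record
    { Carrier = Fraction
    ; _≈_ = _≈ᶠ_
    ; _+_ = _+ᶠ_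
    ; _*_ = _*ᶠ_
    ; -_  = -ᶠ_
    ; 0#  = embed 0#
    ; 1#  = embed 1#
    ; isCommutativeRing = record
      { isRing = record
        { +-isAbelianGroup = record
          { isGroup = record
            { isMonoid = record
              { isSemigroup = record
                { isMagma = record
                  { isEquivalence = record
                    { refl  = cross refl
                    ; sym   = λ p → cross (sym (cross-≈ p))
                    ; trans = ≈ᶠ-trans
                    }
                  ; ∙-cong = +ᶠ-cong
                  }
                ; assoc = +ᶠ-assoc
                }
              ; identity = +ᶠ-identityˡ
                         , (λ x → ≈ᶠ-trans (+ᶠ-comm x (embed 0#)) (+ᶠ-identityˡ x))
              }
            ; inverse = -ᶠ-inverseˡ
                      , (λ x → ≈ᶠ-trans (+ᶠ-comm x (-ᶠ x)) (-ᶠ-inverseˡ x))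
            ; ⁻¹-cong = -ᶠ-cong
            }
          ; comm = +ᶠ-comm
          }
        ; *-cong = *ᶠ-cong
        ; *-assoc = *ᶠ-assoc
        ; *-identity = *ᶠ-identityˡ
                     , (λ x → ≈ᶠ-trans (*ᶠ-comm x (embed 1#)) (*ᶠ-identityˡ x))
        ; distrib = (λ x y z → ≈ᶠ-trans (*ᶠ-comm x (y +ᶠ z))
                       (≈ᶠ-trans (*ᶠ-distribʳ x y z) (+ᶠ-cong (*ᶠ-comm y x) (*ᶠ-comm z x))))
                  , *ᶠ-distribʳ
        }
      ; *-comm = *ᶠ-comm
      }
    }

  inverse : (x : Fraction) → ¬ x ≈ᶠ embed 0# → Fraction
  num   (inverse x x≉0) = den x
  den   (inverse x x≉0) = num x
  den≉0 (inverse x x≉0) a≈0 =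
    x≉0 (cross (trans (*-congʳ a≈0) (trans (zeroˡ _) (sym (zeroˡ _)))))

  inverse-correct : ∀ x x≉0 → x *ᶠ inverse x x≉0 ≈ᶠ embed 1#
  inverse-correct x _ = cross (trans (*-comm _ _) (*-congˡ (*-comm _ _)))

module ℚ[x] where
  open CommutativeRing (Polynomials.polynomialRing ℚ.+-*-commutativeRing) public
  open SemiringExp semiring public using (_^_)

open Polynomials ℚ.+-*-commutativeRing public
  using (Polynomial; coeff; bound; vanish; constant; X; coefficientwise; coeff-≈)

private
  module ℚ[x][[u]] = PowerSeries (Polynomials.polynomialRing ℚ.+-*-commutativeRing)

1/_! : ℕ → ℚ
1/ n ! = (+ 1 ℚ./ (n !)) {{n ℕ.!≢0}}

-- e^{tu} as a series in u
exp[_u] : Polynomial → ℚ[x][[u]].Series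
exp[ t u] n = constant (1/ n !) ℚ[x].* t ℚ[x].^ n

exp[u]-1 : ℚ[x][[u]].Series
exp[u]-1 = exp[ ℚ[x].1# u] ℚ[x][[u]].+ˢ (ℚ[x][[u]].-ˢ ℚ[x][[u]].1ˢ)

-- u e^{xu} / (e^u - 1), computed as e^{xu} divided by the series (e^u - 1) / u,
-- whose constant term is 1.
bernoulliSeries : ℚ[x][[u]].Series
bernoulliSeries = ℚ[x][[u]].divide exp[ X u] (ℚ[x][[u]].tail exp[u]-1)

bernoulli : ℕ → Polynomial
bernoulli m = constant ((+ (m !)) ℚ./ 1) ℚ[x].* bernoulliSeries m

-- (e^u - 1) Σ B_m(x) u^m / m! = u e^{xu}
bernoulli-generating-function :
  exp[u]-1 ℚ[x][[u]].*ˢ (λ m → constant (1/ m !) ℚ[x].* bernoulli m)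
    ℚ[x][[u]].≈ˢ ℚ[x][[u]].u ℚ[x][[u]].*ˢ exp[ X u]
bernoulli-generating-function m = trans
  (*ˢ-cong {exp[u]-1} (λ _ → refl) cancel-m! m)
  (divide-shifted exp[u]-1 exp[ X u] exp[u]-1₀≈0 exp[u]-1₁≈1 m)
  where
  open CommutativeRing (Polynomials.polynomialRing ℚ.+-*-commutativeRing)
  open PowerSeries (Polynomials.polynomialRing ℚ.+-*-commutativeRing)
  open SetoidReasoning setoid

  1/n*n≡1 : ∀ n .{{_ : ℕ.NonZero n}} → (+ 1 ℚ./ n) ℚ.* (+ n ℚ./ 1) ≡ 1ℚ
  1/n*n≡1 (suc k) = ℚ.toℚᵘ-injective
    (ℚᵘ.≃-trans (ℚ.toℚᵘ-homo-* (+ 1 ℚ./ suc k) (+ suc k ℚ./ 1))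
    (ℚᵘ.≃-trans (ℚᵘ.*-cong (ℚ.toℚᵘ-fromℚᵘ (ℚᵘ.mkℚᵘ (+ 1) k))
                           (ℚ.toℚᵘ-fromℚᵘ (ℚᵘ.mkℚᵘ (+ suc k) 0)))
                (ℚᵘ.*-inverseʳ (ℚᵘ.mkℚᵘ (+ 1) k))))

  constant-1 : ∀ a b → a ℚ.* b ≡ 1ℚ → constant a * constant b ≈ 1#
  constant-1 a b ab≡1 = coefficientwise λ
    { zero    → ≡.trans (constant-* (coeff (constant b)) 0) ab≡1
    ; (suc n) → ≡.trans (constant-* (coeff (constant b)) (suc n)) (ℚ.*-zeroʳ a)
    }
    where constant-* = PowerSeries.constantˢ-*ˢ ℚ.+-*-commutativeRing a

  cancel-m! : (λ k → constant (1/ k !) * bernoulli k) ≈ˢ bernoulliSeries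
  cancel-m! k = begin
    constant (1/ k !) * (constant (+ (k !) ℚ./ 1) * bernoulliSeries k)
      ≈⟨ *-assoc _ _ _ ⟨
    (constant (1/ k !) * constant (+ (k !) ℚ./ 1)) * bernoulliSeries k
      ≈⟨ *-congʳ (constant-1 (1/ k !) (+ (k !) ℚ./ 1) (1/n*n≡1 (k !) {{k ℕ.!≢0}})) ⟩
    1# * bernoulliSeries k
      ≈⟨ *-identityˡ _ ⟩
    bernoulliSeries k ∎

  exp[u]-1₀≈0 : exp[u]-1 0 ≈ 0#
  exp[u]-1₀≈0 = trans (+-congʳ (*-identityˡ 1#)) (-‿inverseʳ 1#)

  exp[u]-1₁≈1 : exp[u]-1 1 ≈ 1#
  exp[u]-1₁≈1 = trans
    (+-cong (trans (*-identityˡ _) (*-identityˡ _)) (RingProperties.-0#≈0# ring))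
    (+-identityʳ 1#)

private
  ℚ-cancel : AlmostLeftCancellative _≡_ 0ℚ ℚ._*_
  ℚ-cancel x y z x≢0 xy≡xz = begin
    y                        ≡⟨ ≡.sym (ℚ.*-identityˡ y) ⟩
    1ℚ ℚ.* y                 ≡⟨ ≡.cong (ℚ._* y) (≡.sym (ℚ.*-inverseˡ x)) ⟩
    (ℚ.1/ x ℚ.* x) ℚ.* y     ≡⟨ ℚ.*-assoc (ℚ.1/ x) x y ⟩
    ℚ.1/ x ℚ.* (x ℚ.* y)     ≡⟨ ≡.cong (ℚ.1/ x ℚ.*_) xy≡xz ⟩
    ℚ.1/ x ℚ.* (x ℚ.* z)     ≡⟨ ≡.sym (ℚ.*-assoc (ℚ.1/ x) x z) ⟩
    (ℚ.1/ x ℚ.* x) ℚ.* z     ≡⟨ ≡.cong (ℚ._* z) (ℚ.*-inverseˡ x) ⟩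
    1ℚ ℚ.* z                 ≡⟨ ℚ.*-identityˡ z ⟩
    z                        ∎
    where
    open Relation.Binary.PropositionalEquality.≡-Reasoning
    instance
      x-nonZero : ℚ.NonZero x
      x-nonZero = ℚ.≢-nonZero x≢0

  ℚ[α]-1≉0 : ¬ ℚ[x].1# ℚ[x].≈ ℚ[x].0#
  ℚ[α]-1≉0 p with coeff-≈ p 0
  ... | ()

  ℚ[α]-cancel : AlmostLeftCancellative ℚ[x]._≈_ ℚ[x].0# ℚ[x]._*_
  ℚ[α]-cancel p q r p≉0 pq≈pr = coefficientwise
    (PowerSeries.*ˢ-cancelˡ ℚ.+-*-commutativeRing ℚ._≟_ ℚ-cancel (coeff p) (coeff q) (coeff r)
      (λ p≈0 → p≉0 (coefficientwise p≈0)) (coeff-≈ pq≈pr))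

open Fractions (Polynomials.polynomialRing ℚ.+-*-commutativeRing) ℚ[α]-1≉0 ℚ[α]-cancel public
  using (Fraction; num; den; den≉0; embed; cross; cross-≈; inverse; inverse-correct; fractionRing)

open CommutativeRing fractionRing public
  using (_≈_; _+_; _*_; _-_; -_; 0#; 1#)
  renaming (Carrier to ℚ⟨α⟩)
open SemiringExp (CommutativeRing.semiring fractionRing) public using (_^_)
open MonoidMult (CommutativeRing.+-monoid fractionRing) public using ()
  renaming (_×_ to infixr 8 _·_)
open MonoidSum (CommutativeRing.+-monoid fractionRing) public using (sum; sum-syntax)

rational : ℚ → ℚ⟨α⟩
rational a = embed (constant a)

α : ℚ⟨α⟩
α = embed X

α≉0 : ¬ α ≈ 0#
α≉0 p with coeff-≈ (cross-≈ p) 1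
... | ()

θ : ℚ⟨α⟩
θ = inverse α α≉0

evaluate : Polynomial → ℚ⟨α⟩ → ℚ⟨α⟩
evaluate p x = ∑[ k < bound p ] (rational (coeff p (toℕ k)) * x ^ toℕ k)

-- Rows and columns are numbered from 0: the indices i and j below stand for i - 1 and j - 1 in 1-based numbering.

record Partition : Set where
  field
    parts      : List ℕ
    decreasing : Linked _≥_ parts
    positive   : All (_> 0) parts
open Partition public

len : Partition → ℕ
len μ = length (parts μ)

infixl 9 _at_
_at_ : List ℕ → ℕ → ℕ
[]       at _     = 0
(m ∷ ms) at zero  = m
(m ∷ ms) at suc i = ms at i

row : Partition → ℕ → ℕ
row μ i = parts μ at i

∑rows : Partition → (ℕ → ℚ⟨α⟩) → ℚ⟨α⟩
∑rows μ f = ∑[ i < len μ ] f (toℕ i)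

∑boxes : Partition → (ℕ → ℕ → ℚ⟨α⟩) → ℚ⟨α⟩
∑boxes μ f = ∑rows μ (λ i → ∑[ j < row μ i ] f i (toℕ j))

-- n · x is the n-fold sum x + … + x
content : ℕ → ℕ → ℚ⟨α⟩
content i j = j · α - i · 1#

contentMoment : ℕ → Partition → ℚ⟨α⟩
contentMoment r μ = ∑boxes μ (λ i j → content i j ^ r)

A : Partition → ℕ → ℚ⟨α⟩
A μ i = row μ i · 1# - i · θ

A₀ : ℕ → ℚ⟨α⟩
A₀ i = - (i · θ)

-- Rows beyond the length contribute nothing to sums of differences f(A_i(μ)) - f(A_i(0)).
A-beyond : ∀ μ i → len μ ≤ i → A μ i ≈ A₀ i
A-beyond μ i ℓ≤i = trans (reflexive (≡.cong (λ m → m · 1# - i · θ) (at-beyond (parts μ) i ℓ≤i)))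
                         (+-identityˡ (- (i · θ)))
  where
  open CommutativeRing fractionRing using (trans; reflexive; +-identityˡ)
  at-beyond : ∀ ms i → length ms ≤ i → ms at i ≡ 0
  at-beyond []       i       _       = ≡.refl
  at-beyond (m ∷ ms) (suc i) (s≤s p) = at-beyond ms i p

q : ℕ → Partition → ℚ⟨α⟩
q s μ = ∑rows μ (λ i → A μ i ^ s - (A μ i - θ) ^ s - A₀ i ^ s + (A₀ i - θ) ^ s)

-- The unital ℚ(α)-subalgebra of functions on partitions generated by a family;
-- functions are identified when they agree pointwise.
data Generated {I : Set} (g : I → Partition → ℚ⟨α⟩) : (Partition → ℚ⟨α⟩) → Set where
  generator : ∀ i → Generated g (g i)
  scalar    : ∀ a → Generated g (λ _ → a)
  sum-closed     : ∀ {f h} → Generated g f → Generated g h → Generated g (λ μ → f μ + h μ)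
  product-closed : ∀ {f h} → Generated g f → Generated g h → Generated g (λ μ → f μ * h μ)
  respects  : ∀ {f h} → (∀ μ → f μ ≈ h μ) → Generated g f → Generated g h

qAlgebra : (Partition → ℚ⟨α⟩) → Set
qAlgebra = Generated {∃ λ s → 2 ≤ s} (λ i → q (proj₁ i))

{-# OPTIONS --safe #-}
-- Multiplying the generating function by e^u - 1 and using e^{(x+1)u} = e^u e^{xu} gives
-- B_n(x + 1) - B_n(x) = n x^{n-1} at every point x of a commutative ℚ-algebra.  In row i the
-- contents are α (x + j) with x = A_i(0) and 0 ≤ j < λ_i, so the sum of their r-th powers
-- telescopes to the Bernoulli difference at x and x + λ_i = A_i(λ).
-- For the algebra, q_s is the sum over the rows of Δ_s(A_i(λ)) - Δ_s(A_i(0)), where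
-- Δ_s(x) = x^s - (x - θ)^s.  Since Δ_{n+1} has degree n and the invertible leading coefficient
-- (n + 1) θ, every polynomial is a combination of the Δ_s; constants and Δ_1 contribute nothing,
-- which leaves s ≥ 2.
module Submission where

open import Algebra.Bundles using (CommutativeRing)
open import Algebra.Morphism.Construct.Composition using (isRingHomomorphism)
open import Algebra.Morphism.Structures using (module RingMorphisms)
import Algebra.Properties.AbelianGroup as AbelianGroupProperties
import Algebra.Properties.CommutativeSemiring.Binomial as Binomial
import Algebra.Properties.CommutativeSemiring.Exp as Exp
import Algebra.Properties.Group as GroupProperties
import Algebra.Properties.Ring as RingProperties
import Algebra.Properties.Semiring.Mult as Mult
import Algebra.Properties.Semiring.Sum as Sum
import Algebra.Solver.Ring.NaturalCoefficients.Default as SemiringSolver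
open import Data.Fin.Base using (Fin; toℕ; zero; suc)
import Data.Fin.Properties as Fin
open import Data.Integer.Base as ℤ using (+_)
import Data.Integer.Properties as ℤ
open import Data.Nat.Base as ℕ using (ℕ; zero; suc; _∸_; _≤_; _<_; z≤n; s≤s; _!)
open import Data.Nat.Combinatorics using (_C_; nCk≡n!/k![n-k]!; k![n∸k]!∣n!)
open import Data.Nat.DivMod using (m/n*n≡m)
open import Data.Nat.Induction using (<-rec)
import Data.Nat.Properties as ℕ
open import Data.Product.Base using (∃; _×_; _,_)
open import Data.Rational.Base as ℚ using (ℚ; 1ℚ; _/_)
import Data.Rational.Properties as ℚ
import Data.Rational.Unnormalised.Base as ℚᵘ
import Data.Rational.Unnormalised.Properties as ℚᵘ
open import Level using (0ℓ; _⊔_)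
open import Relation.Binary.PropositionalEquality.Core as ≡ using (_≡_)
import Relation.Binary.Reasoning.Setoid as SetoidReasoning
open import Defs using (module PowerSeries; module Polynomials)

IsRingHom : ∀ {a b c d} (R : CommutativeRing a b) (S : CommutativeRing c d) →
            (CommutativeRing.Carrier R → CommutativeRing.Carrier S) → Set (a ⊔ b ⊔ d)
IsRingHom R S =
  RingMorphisms.IsRingHomomorphism (CommutativeRing.rawRing R) (CommutativeRing.rawRing S)

-- Cancellation for formal power series.

module SeriesProperties {c ℓ} (R : CommutativeRing c ℓ) where
  open CommutativeRing R
  open PowerSeries R

  seriesRing : CommutativeRing c ℓ
  seriesRing = record { isCommutativeRing = isCommutativeRingˢ }

  open CommutativeRing seriesRing public using () renaming
    ( setoid to setoidˢ; sym to symˢ; trans to transˢ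
    ; *-congˡ to *ˢ-congˡ; *-congʳ to *ˢ-congʳ; ring to ringˢ )
  open SetoidReasoning setoidˢ

  u*ˢ-suc : ∀ f n → (u *ˢ f) (suc n) ≈ f n
  u*ˢ-suc f n = trans (+-congʳ (zeroˡ _)) (trans (+-identityˡ _) (*ˢ-identityˡ f n))

  u*ˢ-cancelˡ : ∀ {f g} → u *ˢ f ≈ˢ u *ˢ g → f ≈ˢ g
  u*ˢ-cancelˡ {f} {g} p n = trans (sym (u*ˢ-suc f n)) (trans (p (suc n)) (u*ˢ-suc g n))

  module _ {f : Series} (f₀≈0 : f 0 ≈ 0#) (f₁≈1 : f 1 ≈ 1#) where

    private
      -- `f 0 ≈ 0#` makes `f` the product of `u` and `tail f`, and `f 1 ≈ 1#` lets long division
      -- invert `tail f`. Cancelling through this inverse works over a ring that may have zero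
      -- divisors.
      tail⁻¹ : Series
      tail⁻¹ = divide 1ˢ (tail f)

      tail⁻¹*f≈u : ∀ g → tail⁻¹ *ˢ (f *ˢ g) ≈ˢ u *ˢ g
      tail⁻¹*f≈u g = begin
        tail⁻¹ *ˢ (f *ˢ g)   ≈⟨ symˢ (*ˢ-assoc tail⁻¹ f g) ⟩
        (tail⁻¹ *ˢ f) *ˢ g   ≈⟨ *ˢ-congʳ (*ˢ-comm tail⁻¹ f) ⟩
        (f *ˢ tail⁻¹) *ˢ g   ≈⟨ *ˢ-congʳ (divide-shifted f 1ˢ f₀≈0 f₁≈1) ⟩
        (u *ˢ 1ˢ) *ˢ g       ≈⟨ *ˢ-assoc u 1ˢ g ⟩
        u *ˢ (1ˢ *ˢ g)       ≈⟨ *ˢ-congˡ {u} (*ˢ-identityˡ g) ⟩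
        u *ˢ g               ∎

    -- f is u times a unit, so cancelling it amounts to cancelling u.
    order-1-cancelˡ : ∀ {g h} → f *ˢ g ≈ˢ f *ˢ h → g ≈ˢ h
    order-1-cancelˡ {g} {h} p = u*ˢ-cancelˡ
      (transˢ (symˢ (tail⁻¹*f≈u g)) (transˢ (*ˢ-congˡ {tail⁻¹} p) (tail⁻¹*f≈u h)))

-- Ring homomorphisms on powers, multiples, sums and series.

module Homomorphism {a b c d} (R : CommutativeRing a b) (S : CommutativeRing c d)
  {φ : CommutativeRing.Carrier R → CommutativeRing.Carrier S}
  (hom : IsRingHom R S φ) where

  private
    module R = CommutativeRing R
    module RExp = Exp R.commutativeSemiring
    module RMult = Mult R.semiring
    module RSum = Sum R.semiring
  module Rˢ = PowerSeries R
  open CommutativeRing S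
  open Exp commutativeSemiring
  open Mult semiring renaming (_×_ to infixr 8 _·_)
  open Sum semiring
  open PowerSeries S
  open RingMorphisms.IsRingHomomorphism hom

  ^-homo : ∀ x n → φ (x RExp.^ n) ≈ φ x ^ n
  ^-homo x zero    = 1#-homo
  ^-homo x (suc n) = trans (*-homo _ _) (*-congˡ (^-homo x n))

  ×-homo : ∀ n x → φ (n RMult.× x) ≈ n · φ x
  ×-homo zero    x = 0#-homo
  ×-homo (suc n) x = trans (+-homo _ _) (+-congˡ (×-homo n x))

  sum-homo : ∀ {n} (t : Fin n → R.Carrier) → φ (RSum.sum t) ≈ sum (λ i → φ (t i))
  sum-homo {zero}  t = 0#-homo
  sum-homo {suc n} t = trans (+-homo _ _) (+-congˡ (sum-homo (λ i → t (suc i))))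

  *ˢ-homo : ∀ f g n → φ ((f Rˢ.*ˢ g) n) ≈ ((λ k → φ (f k)) *ˢ (λ k → φ (g k))) n
  *ˢ-homo f g n = trans
    (sum-homo {suc n} (λ k → f (toℕ k) R.* g (n ∸ toℕ k)))
    (sum-cong-≋ {suc n} (λ k → *-homo (f (toℕ k)) (g (n ∸ toℕ k))))

  1ˢ-homo : ∀ n → φ (Rˢ.1ˢ n) ≈ 1ˢ n
  1ˢ-homo zero    = 1#-homo
  1ˢ-homo (suc n) = 0#-homo

  u-homo : ∀ n → φ (Rˢ.u n) ≈ u n
  u-homo zero    = 0#-homo
  u-homo (suc n) = 1ˢ-homo n

-- Evaluation of polynomials at a point.

module Evaluation {a b c d} (R : CommutativeRing a b) (S : CommutativeRing c d)
  {φ : CommutativeRing.Carrier R → CommutativeRing.Carrier S}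
  (hom : IsRingHom R S φ) (x : CommutativeRing.Carrier S) where

  private module R = CommutativeRing R
  open PowerSeries R
  open Polynomials R
  open CommutativeRing S
  open Exp commutativeSemiring
  open Sum semiring
  open GroupProperties +-group using (inverseˡ-unique)
  open SemiringSolver commutativeSemiring using (solve; _:=_; _:+_; _:*_)
  open SetoidReasoning setoid
  open RingMorphisms.IsRingHomomorphism hom

  -- The length is a free parameter, not the bound stored in a polynomial, so polynomials with
  -- different bounds can be compared at a common length.
  truncated : ℕ → Series → Carrier
  truncated N f = ∑[ k < N ] (φ (f (toℕ k)) * x ^ toℕ k)

  truncated-cong : ∀ N {f g} → f ≈ˢ g → truncated N f ≈ truncated N g
  truncated-cong N f≈g = sum-cong-≋ {N} (λ k → *-congʳ (⟦⟧-cong (f≈g (toℕ k))))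

  truncated-+ : ∀ N f g → truncated N (f +ˢ g) ≈ truncated N f + truncated N g
  truncated-+ N f g = trans
    (sum-cong-≋ {N} (λ k → trans (*-congʳ (+-homo _ _)) (distribʳ _ _ _)))
    (∑-distrib-+ {N} _ _)

  truncated-scale : ∀ N r f → truncated N (λ k → r R.* f k) ≈ φ r * truncated N f
  truncated-scale N r f = trans
    (sum-cong-≋ {N} (λ k → trans (*-congʳ (*-homo _ _)) (*-assoc _ _ _)))
    (sym (*-distribˡ-sum {N} _ _))

  -- One step of Horner's scheme. It matches the recursion of `*ˢ` through `tail`, so that later
  -- inductions can run on the length.
  horner : ∀ N f → truncated (suc N) f ≈ φ (f 0) + x * truncated N (tail f)
  horner N f = +-cong (*-identityʳ _) (trans
    (sum-cong-≋ {N} (λ k → solve 3 (λ a x y → a :* (x :* y) := x :* (a :* y)) refl _ _ _))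
    (sym (*-distribˡ-sum {N} _ _)))

  VanishesFrom : ℕ → Series → Set b
  VanishesFrom N f = ∀ n → N ≤ n → f n R.≈ R.0#

  tail-vanishes : ∀ {N f} → VanishesFrom (suc N) f → VanishesFrom N (tail f)
  tail-vanishes v n N≤n = v (suc n) (s≤s N≤n)

  truncated-zero : ∀ N f → VanishesFrom 0 f → truncated N f ≈ 0#
  truncated-zero N f v = trans
    (sum-cong-≋ {N} (λ k → trans (*-congʳ (trans (⟦⟧-cong (v (toℕ k) z≤n)) 0#-homo)) (zeroˡ _)))
    (sum-replicate-zero N)

  -- Bounds of polynomials need not be optimal; this makes the value at a point independent of the
  -- bound.
  truncated-stable : ∀ {M N} f → VanishesFrom M f → M ≤ N → truncated N f ≈ truncated M f
  truncated-stable {N = N} f v z≤n = truncated-zero N f v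
  truncated-stable {suc M} {suc N} f v (s≤s M≤N) = begin
    truncated (suc N) f                   ≈⟨ horner N f ⟩
    φ (f 0) + x * truncated N (tail f)
      ≈⟨ +-congˡ (*-congˡ (truncated-stable (tail f) (tail-vanishes v) M≤N)) ⟩
    φ (f 0) + x * truncated M (tail f)   ≈⟨ sym (horner M f) ⟩
    truncated (suc M) f                  ∎

  -- Induction on `M`. The series `tail (f *ˢ g)` is `f 0` times `tail g` plus `tail f *ˢ g`, so a
  -- Horner step reduces the product to one whose left factor is shorter.
  truncated-* : ∀ M N {f g} → VanishesFrom M f → VanishesFrom N g →
                truncated (M ℕ.+ N) (f *ˢ g) ≈ truncated M f * truncated N g
  truncated-* zero N {f} {g} vf vg = trans
    (truncated-zero N (f *ˢ g) (λ n _ →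
      R.trans (*ˢ-cong {f} {0ˢ} {g} (λ k → vf k z≤n) (λ _ → R.refl) n) (*ˢ-zeroˡ g n)))
    (sym (zeroˡ _))
  truncated-* (suc M) N {f} {g} vf vg = begin
    truncated (suc (M ℕ.+ N)) (f *ˢ g)
      ≈⟨ horner (M ℕ.+ N) (f *ˢ g) ⟩
    φ ((f *ˢ g) 0) + x * truncated (M ℕ.+ N) (tail (f *ˢ g))
      ≈⟨ +-cong (trans (⟦⟧-cong (R.+-identityʳ _)) (*-homo _ _)) (*-congˡ (begin
           truncated (M ℕ.+ N) (tail (f *ˢ g))
             ≈⟨ truncated-+ (M ℕ.+ N) (λ k → f 0 R.* tail g k) (tail f *ˢ g) ⟩
           truncated (M ℕ.+ N) (λ k → f 0 R.* tail g k) + truncated (M ℕ.+ N) (tail f *ˢ g)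
             ≈⟨ +-cong (truncated-scale (M ℕ.+ N) (f 0) (tail g))
                       (truncated-* M N (tail-vanishes vf) vg) ⟩
           φ (f 0) * truncated (M ℕ.+ N) (tail g) + truncated M (tail f) * truncated N g ∎)) ⟩
    φ (f 0) * φ (g 0)
      + x * (φ (f 0) * truncated (M ℕ.+ N) (tail g) + truncated M (tail f) * truncated N g)
      ≈⟨ solve 6 (λ a b x s t w → a :* b :+ x :* (a :* s :+ t :* w)
                    := a :* (b :+ x :* s) :+ (x :* t) :* w) refl _ _ _ _ _ _ ⟩
    φ (f 0) * (φ (g 0) + x * truncated (M ℕ.+ N) (tail g)) + (x * truncated M (tail f)) * truncated N g
      -- Reassembling `g` gives it the length `suc (M + N)`; the terms from index `N` on vanish.
      ≈⟨ +-congʳ (*-congˡ (trans (sym (horner (M ℕ.+ N) g))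
                                 (truncated-stable g vg (ℕ.m≤n⇒m≤1+n (ℕ.m≤n+m N M))))) ⟩
    φ (f 0) * truncated N g + (x * truncated M (tail f)) * truncated N g
      ≈⟨ sym (distribʳ _ _ _) ⟩
    (φ (f 0) + x * truncated M (tail f)) * truncated N g
      ≈⟨ *-congʳ (sym (horner M f)) ⟩
    truncated (suc M) f * truncated N g ∎

  eval : Polynomial → Carrier
  eval p = truncated (bound p) (coeff p)

  private
    extend : ∀ p {N} → bound p ≤ N → truncated N (coeff p) ≈ eval p
    extend p = truncated-stable (coeff p) (vanish p)

  eval-cong : ∀ {p q} → p ≈ᵖ q → eval p ≈ eval q
  eval-cong {p} {q} p≈q = begin
    eval p                                   ≈⟨ extend p (ℕ.m≤m⊔n (bound p) (bound q)) ⟨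
    truncated (bound p ℕ.⊔ bound q) (coeff p)
      ≈⟨ truncated-cong (bound p ℕ.⊔ bound q) (coeff-≈ p≈q) ⟩
    truncated (bound p ℕ.⊔ bound q) (coeff q)   ≈⟨ extend q (ℕ.m≤n⊔m (bound p) (bound q)) ⟩
    eval q                                      ∎

  eval-+ : ∀ p q → eval (p +ᵖ q) ≈ eval p + eval q
  eval-+ p q = trans (truncated-+ (bound p ℕ.⊔ bound q) (coeff p) (coeff q))
    (+-cong (extend p (ℕ.m≤m⊔n (bound p) (bound q))) (extend q (ℕ.m≤n⊔m (bound p) (bound q))))

  eval-constant : ∀ r → eval (constant r) ≈ φ r
  eval-constant r = trans (+-identityʳ _) (*-identityʳ _)

  eval-X : eval X ≈ x
  eval-X = begin
    eval X                                                 ≈⟨ horner 1 u ⟩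
    φ R.0# + x * (φ R.1# * 1# + 0#)
      ≈⟨ +-cong 0#-homo (*-congˡ (trans (+-identityʳ _) (*-identityʳ _))) ⟩
    0# + x * φ R.1#   ≈⟨ +-identityˡ _ ⟩
    x * φ R.1#        ≈⟨ *-congˡ 1#-homo ⟩
    x * 1#            ≈⟨ *-identityʳ x ⟩
    x                 ∎

  eval-isRingHom : IsRingHom polynomialRing S eval
  eval-isRingHom = record
    { isSemiringHomomorphism = record
      { isNearSemiringHomomorphism = record
        { +-isMonoidHomomorphism = record
          { isMagmaHomomorphism = record
            { isRelHomomorphism = record { cong = λ {p} {q} → eval-cong {p} {q} }
            ; homo = eval-+
            }
          ; ε-homo = refl
          }
        ; *-homo = λ p q → truncated-* (bound p) (bound q) (vanish p) (vanish q)
        }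
      ; 1#-homo = trans (eval-constant R.1#) 1#-homo
      }
    ; -‿homo = λ p → inverseˡ-unique (eval (-ᵖ p)) (eval p)
        (trans (sym (eval-+ (-ᵖ p) p))
               (eval-cong {(-ᵖ p) +ᵖ p} {0ᵖ} (CommutativeRing.-‿inverseˡ polynomialRing p)))
    }

-- Constants in a polynomial ring.

module ConstantHom {c ℓ} (R : CommutativeRing c ℓ) where
  open CommutativeRing R
  open PowerSeries R using (constantˢ-*ˢ)
  private module R[X] = Polynomials R

  constant-isRingHom : IsRingHom R R[X].polynomialRing R[X].constant
  constant-isRingHom = record
    { isSemiringHomomorphism = record
      { isNearSemiringHomomorphism = record
        { +-isMonoidHomomorphism = record
          { isMagmaHomomorphism = record
            { isRelHomomorphism = record
                { cong = λ a≈b → R[X].coefficientwise λ { zero → a≈b ; (suc n) → refl } }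
            ; homo = λ a b → R[X].coefficientwise λ { zero → refl ; (suc n) → sym (+-identityˡ 0#) }
            }
          ; ε-homo = R[X].coefficientwise λ { zero → refl ; (suc n) → refl }
          }
        ; *-homo = λ a b → R[X].coefficientwise λ
            { zero    → sym (constantˢ-*ˢ a (R[X].coeff (R[X].constant b)) 0)
            ; (suc n) → sym (trans (constantˢ-*ˢ a (R[X].coeff (R[X].constant b)) (suc n)) (zeroʳ a))
            }
        }
      ; 1#-homo = R[X].coefficientwise λ n → refl
      }
    ; -‿homo = λ a → R[X].coefficientwise λ
        { zero    → refl
        ; (suc n) → sym (RingProperties.-0#≈0# ring)
        }
    }

open import Defs using
  ( Polynomial; constant; X
  ; 1/_!; exp[_u]; exp[u]-1; bernoulli; bernoulli-generating-function )

-- Unit fractions in ℚ.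

private
  ℚ-ring : CommutativeRing 0ℓ 0ℓ
  ℚ-ring = ℚ.+-*-commutativeRing
open Mult (CommutativeRing.semiring ℚ-ring) using () renaming (_×_ to _×ℚ_)

m×1/n≡m/n : ∀ m n .{{_ : ℕ.NonZero n}} → m ×ℚ (+ 1 / n) ≡ + m / n
m×1/n≡m/n zero    n           = ≡.sym (ℚ.0/n≡0 n)
m×1/n≡m/n (suc m) n@(suc n-1) = ≡.trans (≡.cong (+ 1 / n ℚ.+_) (m×1/n≡m/n m n))
  (ℚ.toℚᵘ-injective (begin
    ℚ.toℚᵘ (+ 1 / n ℚ.+ + m / n)                   ≈⟨ ℚ.toℚᵘ-homo-+ (+ 1 / n) (+ m / n) ⟩
    ℚ.toℚᵘ (+ 1 / n) ℚᵘ.+ ℚ.toℚᵘ (+ m / n)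
      ≈⟨ ℚᵘ.+-cong (ℚ.toℚᵘ-fromℚᵘ (ℚᵘ.mkℚᵘ (+ 1) n-1)) (ℚ.toℚᵘ-fromℚᵘ (ℚᵘ.mkℚᵘ (+ m) n-1)) ⟩
    -- Unnormalised addition yields the denominator `n * n`, so a cross-multiplication remains to be
    -- checked.
    ℚᵘ.mkℚᵘ (+ 1) n-1 ℚᵘ.+ ℚᵘ.mkℚᵘ (+ m) n-1   ≈⟨ ℚᵘ.*≡* common-denominator ⟩
    ℚᵘ.mkℚᵘ (+ suc m) n-1                      ≈⟨ ℚ.toℚᵘ-fromℚᵘ (ℚᵘ.mkℚᵘ (+ suc m) n-1) ⟨
    ℚ.toℚᵘ (+ suc m / n)                       ∎))
  where
  open SetoidReasoning ℚᵘ.≃-setoid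
  common-denominator : (+ 1 ℤ.* + n ℤ.+ + m ℤ.* + n) ℤ.* + n ≡ + suc m ℤ.* (+ n ℤ.* + n)
  common-denominator = ≡.trans
    (≡.cong (ℤ._* + n) (≡.sym (ℤ.*-distribʳ-+ (+ n) (+ 1) (+ m))))
    (ℤ.*-assoc (+ suc m) (+ n) (+ n))

n/n≡1 : ∀ n .{{_ : ℕ.NonZero n}} → + n / n ≡ 1ℚ
n/n≡1 n@(suc n-1) = ℚ.toℚᵘ-injective
  (ℚᵘ.≃-trans (ℚ.toℚᵘ-fromℚᵘ (ℚᵘ.mkℚᵘ (+ n) n-1)) (ℚᵘ.*≡* (ℤ.*-comm (+ n) (+ 1))))

-- Exponential series over a commutative ℚ-algebra with structure map `ι`.

module Exponential {c ℓ} (S : CommutativeRing c ℓ) {ι : ℚ → CommutativeRing.Carrier S}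
  (hom : IsRingHom ℚ-ring S ι) where

  open CommutativeRing S
  open Exp commutativeSemiring
  open Mult semiring renaming (_×_ to infixr 8 _·_)
  open Sum semiring
  open PowerSeries S
  open SeriesProperties S
  open SetoidReasoning setoid
  open RingMorphisms.IsRingHomomorphism hom

  n×1/n≈1 : ∀ n .{{_ : ℕ.NonZero n}} → n · ι (+ 1 / n) ≈ 1#
  n×1/n≈1 n = begin
    n · ι (+ 1 / n)      ≈⟨ Homomorphism.×-homo ℚ-ring S hom n (+ 1 / n) ⟨
    ι (n ×ℚ (+ 1 / n))   ≈⟨ ⟦⟧-cong (≡.trans (m×1/n≡m/n n n) (n/n≡1 n)) ⟩
    ι 1ℚ                 ≈⟨ 1#-homo ⟩
    1#                   ∎

  1/n*[n×x]≈x : ∀ n .{{_ : ℕ.NonZero n}} x → ι (+ 1 / n) * (n · x) ≈ x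
  1/n*[n×x]≈x n x = begin
    ι (+ 1 / n) * (n · x)   ≈⟨ ×-comm-* n _ x ⟩
    n · (ι (+ 1 / n) * x)   ≈⟨ ×-assoc-* n _ x ⟨
    (n · ι (+ 1 / n)) * x   ≈⟨ *-congʳ (n×1/n≈1 n) ⟩
    1# * x                  ≈⟨ *-identityˡ x ⟩
    x                       ∎

  n×[1/n*x]≈x : ∀ n .{{_ : ℕ.NonZero n}} x → n · (ι (+ 1 / n) * x) ≈ x
  n×[1/n*x]≈x n x = trans (sym (×-comm-* n _ x)) (1/n*[n×x]≈x n x)

  -- The series e^{xu} in `u` for a scalar `x`.
  expˢ : Carrier → Series
  expˢ x n = ι (1/ n !) * x ^ n

  expˢ-cong : ∀ {x y} → x ≈ y → expˢ x ≈ˢ expˢ y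
  expˢ-cong x≈y n = *-congˡ (^-congˡ n x≈y)

  private
    nCk*k!*[n-k]!≡n! : ∀ {n k} → k ≤ n → (n C k) ℕ.* (k ! ℕ.* (n ∸ k) !) ≡ n !
    nCk*k!*[n-k]!≡n! {n} {k} k≤n = ≡.trans
      (≡.cong (ℕ._* (k ! ℕ.* (n ∸ k) !)) (nCk≡n!/k![n-k]! k≤n))
      (m/n*n≡m {{k ℕ.!* (n ∸ k) !≢0}} (k![n∸k]!∣n! k≤n))

    -- The left side is multiplied and divided by n!, written as the binomial coefficient times k!
    -- (n - k)!. Each of these two factorials cancels against its own reciprocal, which leaves the
    -- binomial coefficient.
    convolution-term : ∀ {n k} x y → k ≤ n →
      (ι (1/ k !) * x) * (ι (1/ n ∸ k !) * y) ≈ ι (1/ n !) * ((n C k) · (x * y))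
    convolution-term {n} {k} x y k≤n = begin
      z                          ≈⟨ 1/n*[n×x]≈x (n !) {{n ℕ.!≢0}} z ⟨
      ι (1/ n !) * ((n !) · z)   ≈⟨ *-congˡ (×-congˡ (nCk*k!*[n-k]!≡n! k≤n)) ⟨
      ι (1/ n !) * (((n C k) ℕ.* (k ! ℕ.* l !)) · z)
        ≈⟨ *-congˡ (×-assocˡ z (n C k) (k ! ℕ.* l !)) ⟨
      ι (1/ n !) * ((n C k) · ((k ! ℕ.* l !) · z))        ≈⟨ *-congˡ (×-congʳ (n C k) (begin
         (k ! ℕ.* l !) · z     ≈⟨ ×-assocˡ z (k !) (l !) ⟨
         (k !) · ((l !) · z)   ≈⟨ ×-congʳ (k !) (×-comm-* (l !) _ _) ⟨
         (k !) · ((ι (1/ k !) * x) * ((l !) · (ι (1/ l !) * y)))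
           ≈⟨ ×-congʳ (k !) (*-congˡ (n×[1/n*x]≈x (l !) {{l ℕ.!≢0}} y)) ⟩
         (k !) · ((ι (1/ k !) * x) * y)   ≈⟨ ×-assoc-* (k !) _ y ⟨
         ((k !) · (ι (1/ k !) * x)) * y   ≈⟨ *-congʳ (n×[1/n*x]≈x (k !) {{k ℕ.!≢0}} x) ⟩
         x * y                            ∎)) ⟩
      ι (1/ n !) * ((n C k) · (x * y))           ∎
      where
      l = n ∸ k
      z = (ι (1/ k !) * x) * (ι (1/ l !) * y)

  -- In degree n this is the binomial theorem divided by n!.
  expˢ-+ : ∀ x y → expˢ (x + y) ≈ˢ expˢ x *ˢ expˢ y
  expˢ-+ x y n = begin
    ι (1/ n !) * (x + y) ^ n  ≈⟨ *-congˡ (Binomial.theorem commutativeSemiring n x y) ⟩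
    ι (1/ n !) * ∑[ k ≤ n ] ((n C toℕ k) · (x ^ toℕ k * y ^ (n ∸ toℕ k)))
      ≈⟨ *-distribˡ-sum {suc n} _ (Binomial.binomialTerm commutativeSemiring x y n) ⟩
    ∑[ k ≤ n ] (ι (1/ n !) * ((n C toℕ k) · (x ^ toℕ k * y ^ (n ∸ toℕ k))))
      ≈⟨ sum-cong-≋ {suc n} (λ k →
           convolution-term {n} {toℕ k} (x ^ toℕ k) (y ^ (n ∸ toℕ k)) (Fin.toℕ≤pred[n] k)) ⟨
    (expˢ x *ˢ expˢ y) n  ∎

  -- Multiplied by f = e^u - 1, the claim reads u e^{(1+x)u} - u e^{xu} = f u e^{xu}.
  exp-quotient-difference : ∀ {b b′ x} →
    (expˢ 1# +ˢ -ˢ 1ˢ) *ˢ b ≈ˢ u *ˢ expˢ x →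
    (expˢ 1# +ˢ -ˢ 1ˢ) *ˢ b′ ≈ˢ u *ˢ expˢ (1# + x) →
    b′ +ˢ -ˢ b ≈ˢ u *ˢ expˢ x
  exp-quotient-difference {b} {b′} {x} p p′ = order-1-cancelˡ {f} f₀≈0 f₁≈1 (λ n → begin
    (f *ˢ (b′ +ˢ -ˢ b)) n        ≈⟨ RingProperties.x[y-z]≈xy-xz ringˢ f b′ b n ⟩
    (f *ˢ b′ +ˢ -ˢ (f *ˢ b)) n   ≈⟨ +-cong (p′ n) (-‿cong (p n)) ⟩
    (u *ˢ expˢ (1# + x) +ˢ -ˢ (u *ˢ expˢ x)) n
      ≈⟨ +-cong (*ˢ-congˡ {u} (expˢ-+ 1# x) n)
                (-‿cong (*ˢ-congˡ {u} (symˢ (*ˢ-identityˡ (expˢ x))) n)) ⟩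
    (u *ˢ (expˢ 1# *ˢ expˢ x) +ˢ -ˢ (u *ˢ (1ˢ *ˢ expˢ x))) n
      ≈⟨ RingProperties.x[y-z]≈xy-xz ringˢ u (expˢ 1# *ˢ expˢ x) (1ˢ *ˢ expˢ x) n ⟨
    (u *ˢ (expˢ 1# *ˢ expˢ x +ˢ -ˢ (1ˢ *ˢ expˢ x))) n
      ≈⟨ *ˢ-congˡ {u} (RingProperties.[y-z]x≈yx-zx ringˢ (expˢ x) (expˢ 1#) 1ˢ) n ⟨
    (u *ˢ (f *ˢ expˢ x)) n
      ≈⟨ *ˢ-assoc u f (expˢ x) n ⟨
    ((u *ˢ f) *ˢ expˢ x) n
      ≈⟨ *ˢ-congʳ {expˢ x} (*ˢ-comm u f) n ⟩
    ((f *ˢ u) *ˢ expˢ x) n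
      ≈⟨ *ˢ-assoc f u (expˢ x) n ⟩
    (f *ˢ (u *ˢ expˢ x)) n ∎)
    where
    f = expˢ 1# +ˢ -ˢ 1ˢ
    f₀≈0 : f 0 ≈ 0#
    f₀≈0 = trans (+-congʳ (trans (*-identityʳ _) 1#-homo)) (-‿inverseʳ 1#)
    f₁≈1 : f 1 ≈ 1#
    f₁≈1 = trans
      (+-cong (trans (*-congˡ (*-identityʳ 1#)) (trans (*-identityʳ _) 1#-homo))
              (RingProperties.-0#≈0# ring))
      (+-identityʳ 1#)

-- The difference equation of the Bernoulli polynomials and sums of powers.

module BernoulliDifference {c ℓ} (S : CommutativeRing c ℓ) {ι : ℚ → CommutativeRing.Carrier S}
  (hom : IsRingHom ℚ-ring S ι) where

  open CommutativeRing S
  open Exp commutativeSemiring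
  open Mult semiring renaming (_×_ to infixr 8 _·_)
  open Sum semiring
  open PowerSeries S
  open SeriesProperties S
  open Exponential S hom
  open SetoidReasoning setoid
  private
    ℚ[X] = Polynomials.polynomialRing ℚ-ring
    module ℚ[X] = CommutativeRing ℚ[X]
  open Evaluation ℚ-ring S hom using (eval-constant; eval-X; eval-isRingHom)

  eval : Polynomial → Carrier → Carrier
  eval p x = Evaluation.eval ℚ-ring S hom x p

  eval-congʳ : ∀ p {x y} → x ≈ y → eval p x ≈ eval p y
  eval-congʳ p x≈y = sum-cong-≋ {Polynomial.bound p} (λ k → *-congˡ (^-congˡ (toℕ k) x≈y))

  module _ {ψ : Polynomial → Carrier} (ψ-hom : IsRingHom ℚ[X] S ψ)
    (ψ-constant : ∀ a → ψ (constant a) ≈ ι a) where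

    open RingMorphisms.IsRingHomomorphism ψ-hom
    private module ψ = Homomorphism ℚ[X] S ψ-hom

    exp-homo : ∀ t n → ψ (exp[ t u] n) ≈ expˢ (ψ t) n
    exp-homo t n = trans (*-homo _ _) (*-cong (ψ-constant _) (ψ.^-homo t n))

    exp[u]-1-homo : ∀ n → ψ (exp[u]-1 n) ≈ (expˢ 1# +ˢ -ˢ 1ˢ) n
    exp[u]-1-homo n = trans (+-homo _ _) (+-cong
      (trans (exp-homo ℚ[X].1# n) (expˢ-cong 1#-homo n))
      (trans (-‿homo _) (-‿cong (ψ.1ˢ-homo n))))

    -- The defining identity is carried over coefficient by coefficient. A homomorphism that agrees
    -- with `ι` on constants respects both exponentials, so `X` enters only through its image `ψ X`.
    bernoulli-generating-function-homo :
      (expˢ 1# +ˢ -ˢ 1ˢ) *ˢ (λ k → ι (1/ k !) * ψ (bernoulli k)) ≈ˢ u *ˢ expˢ (ψ X)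
    bernoulli-generating-function-homo n = begin
      ((expˢ 1# +ˢ -ˢ 1ˢ) *ˢ (λ k → ι (1/ k !) * ψ (bernoulli k))) n
        ≈⟨ *ˢ-cong exp[u]-1-homo b-homo n ⟨
      ((λ k → ψ (exp[u]-1 k)) *ˢ (λ k → ψ (b k))) n
        ≈⟨ ψ.*ˢ-homo exp[u]-1 b n ⟨
      ψ ((exp[u]-1 ψ.Rˢ.*ˢ b) n)
        ≈⟨ ⟦⟧-cong (bernoulli-generating-function n) ⟩
      ψ ((ψ.Rˢ.u ψ.Rˢ.*ˢ exp[ X u]) n)
        ≈⟨ ψ.*ˢ-homo ψ.Rˢ.u exp[ X u] n ⟩
      ((λ k → ψ (ψ.Rˢ.u k)) *ˢ (λ k → ψ (exp[ X u] k))) n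
        ≈⟨ *ˢ-cong ψ.u-homo (exp-homo X) n ⟩
      (u *ˢ expˢ (ψ X)) n ∎
      where
      b : ℕ → Polynomial
      b k = constant (1/ k !) ℚ[X].* bernoulli k
      b-homo : ∀ k → ψ (b k) ≈ ι (1/ k !) * ψ (bernoulli k)
      b-homo k = trans (*-homo (constant (1/ k !)) (bernoulli k)) (*-congʳ (ψ-constant (1/ k !)))

  -- The series u e^{xu} / (e^u - 1) at a scalar `x`.
  bernoulliˢ : Carrier → Series
  bernoulliˢ x k = ι (1/ k !) * eval (bernoulli k) x

  bernoulliˢ-generating-function : ∀ x → (expˢ 1# +ˢ -ˢ 1ˢ) *ˢ bernoulliˢ x ≈ˢ u *ˢ expˢ x
  bernoulliˢ-generating-function x = transˢ
    (bernoulli-generating-function-homo (eval-isRingHom x) (eval-constant x))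
    (*ˢ-congˡ {u} (expˢ-cong (eval-X x)))

  -- Compares coefficients in degree r + 1: the generating functions at 1 + x and x differ by u
  -- e^{xu}, whose coefficient is x^r / r!. Multiplying by (r + 1)! = (r + 1) r! leaves the factor r
  -- + 1.
  bernoulli-difference : ∀ r x →
    eval (bernoulli (suc r)) (1# + x) - eval (bernoulli (suc r)) x ≈ suc r · x ^ r
  bernoulli-difference r x = begin
    B′ - B                                   ≈⟨ n×[1/n*x]≈x (n !) {{n ℕ.!≢0}} _ ⟨
    (n !) · (ι (1/ n !) * (B′ - B))
      ≈⟨ ×-congʳ (n !) (RingProperties.x[y-z]≈xy-xz ring _ _ _) ⟩
    (n !) · (bernoulliˢ (1# + x) n - bernoulliˢ x n)
      ≈⟨ ×-congʳ (n !) (exp-quotient-difference {bernoulliˢ x}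
           (bernoulliˢ-generating-function x) (bernoulliˢ-generating-function (1# + x)) n) ⟩
    (n !) · (u *ˢ expˢ x) n              ≈⟨ ×-congʳ (n !) (u*ˢ-suc (expˢ x) r) ⟩
    (n !) · (ι (1/ r !) * x ^ r)         ≈⟨ ×-assocˡ _ n (r !) ⟨
    n · ((r !) · (ι (1/ r !) * x ^ r))   ≈⟨ ×-congʳ n (n×[1/n*x]≈x (r !) {{r ℕ.!≢0}} _) ⟩
    n · x ^ r                            ∎
    where
    n = suc r
    B  = eval (bernoulli n) x
    B′ = eval (bernoulli n) (1# + x)

  -- The difference equation telescopes. The induction moves the base point from `x` to `1# + x`,
  -- because a sum over `Fin` splits off its first term, here `x ^ r`.
  bernoulli-power-sum : ∀ r m x →
    ι (+ 1 / suc r) * (eval (bernoulli (suc r)) (m · 1# + x) - eval (bernoulli (suc r)) x)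
      ≈ ∑[ j < m ] ((toℕ j · 1# + x) ^ r)
  bernoulli-power-sum r zero    x = trans
    (*-congˡ (trans (+-congʳ (eval-congʳ (bernoulli (suc r)) (+-identityˡ x))) (-‿inverseʳ _)))
    (zeroʳ _)
  bernoulli-power-sum r (suc m) x = begin
    ι (+ 1 / suc r) * (B (suc m · 1# + x) - B x)
      ≈⟨ *-congˡ (+-congʳ (eval-congʳ (bernoulli (suc r)) (shift m))) ⟩
    ι (+ 1 / suc r) * (B (m · 1# + (1# + x)) - B x)
      -- The intermediate value `B (1# + x)` is subtracted and added back.
      ≈⟨ *-congˡ (trans
           (+-congʳ (sym (GroupProperties.//-rightDividesˡ +-group (B (1# + x)) _)))
           (+-assoc _ _ _)) ⟩
    ι (+ 1 / suc r) * ((B (m · 1# + (1# + x)) - B (1# + x)) + (B (1# + x) - B x))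
      ≈⟨ distribˡ _ _ _ ⟩
    ι (+ 1 / suc r) * (B (m · 1# + (1# + x)) - B (1# + x)) + ι (+ 1 / suc r) * (B (1# + x) - B x)
      ≈⟨ +-cong
           (bernoulli-power-sum r m (1# + x))
           (trans (*-congˡ (bernoulli-difference r x)) (1/n*[n×x]≈x (suc r) _)) ⟩
    ∑[ j < m ] ((toℕ j · 1# + (1# + x)) ^ r) + x ^ r
      ≈⟨ +-comm _ _ ⟩
    x ^ r + ∑[ j < m ] ((toℕ j · 1# + (1# + x)) ^ r)
      ≈⟨ +-cong
           (^-congˡ r (+-identityˡ x))
           (sum-cong-≋ {m} (λ j → ^-congˡ r (shift (toℕ j)))) ⟨
    ∑[ j < suc m ] ((toℕ j · 1# + x) ^ r) ∎
    where
    B = eval (bernoulli (suc r))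
    shift : ∀ j → suc j · 1# + x ≈ j · 1# + (1# + x)
    shift j = trans (+-congʳ (+-comm _ _)) (+-assoc _ _ _)

-- Monomials expressed through the differences x^s - (x - θ)^s.

module PowerDifferences {c ℓ} (S : CommutativeRing c ℓ) (θ : CommutativeRing.Carrier S) where
  open CommutativeRing S hiding (zero)
  open Exp commutativeSemiring
  open Mult semiring renaming (_×_ to infixr 8 _·_)
  open RingProperties ring using (x[y-z]≈xy-xz; [y-z]x≈yx-zx; -‿distribˡ-*; ⁻¹-anti-homo‿-; -1*x≈-x)
  open SemiringSolver commutativeSemiring using (solve; _:=_; _:+_; _:*_)
  open SetoidReasoning setoid

  -- The polynomial functions of degree below `n`, kept as derivations instead of coefficient lists:
  -- a property closed under these operations passes to every such function by recursion.
  data PowerSpan (n : ℕ) : (Carrier → Carrier) → Set (c ⊔ ℓ) where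
    power    : ∀ {k} → k < n → PowerSpan n (_^ k)
    null     : PowerSpan n (λ _ → 0#)
    add      : ∀ {f g} → PowerSpan n f → PowerSpan n g → PowerSpan n (λ x → f x + g x)
    scale    : ∀ a {f} → PowerSpan n f → PowerSpan n (λ x → a * f x)
    respects : ∀ {f g} → (∀ x → f x ≈ g x) → PowerSpan n f → PowerSpan n g

  x*-span : ∀ {n f} → PowerSpan n f → PowerSpan (suc n) (λ x → x * f x)
  x*-span (power k<n)     = power (s≤s k<n)
  x*-span null            = respects (λ x → sym (zeroʳ x)) null
  x*-span (add f g)       = respects (λ x → sym (distribˡ _ _ _)) (add (x*-span f) (x*-span g))
  x*-span (scale a f)     = respects
    (λ x → solve 3 (λ a x y → a :* (x :* y) := x :* (a :* y)) refl _ _ _)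
    (scale a (x*-span f))
  x*-span (respects eq f) = respects (λ x → *-congˡ (eq x)) (x*-span f)

  weaken : ∀ {n f} → PowerSpan n f → PowerSpan (suc n) f
  weaken (power k<n)     = power (ℕ.m<n⇒m<1+n k<n)
  weaken null            = null
  weaken (add f g)       = add (weaken f) (weaken g)
  weaken (scale a f)     = scale a (weaken f)
  weaken (respects eq f) = respects eq (weaken f)

  Δ : ℕ → Carrier → Carrier
  Δ s x = x ^ s - (x - θ) ^ s

  -- In x x^s - (x - θ) (x - θ)^s the factor (x - θ)^s is replaced by x^s - `Δ s x`, which gives a
  -- recursion in `s`.
  Δ-suc : ∀ s x → Δ (suc s) x ≈ x * Δ s x + (θ * x ^ s + (- θ) * Δ s x)
  Δ-suc s x = begin
    x * P - (x - θ) * Q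
      ≈⟨ +-congˡ (trans (-‿cong ([y-z]x≈yx-zx Q x θ)) (⁻¹-anti-homo‿- _ _)) ⟩
    x * P + (θ * Q - x * Q)
      ≈⟨ solve 3 (λ a b c → a :+ (b :+ c) := (a :+ c) :+ b) refl _ _ _ ⟩
    (x * P - x * Q) + θ * Q        ≈⟨ +-cong (x[y-z]≈xy-xz x P Q) (*-congˡ P-Δ≈Q) ⟨
    x * Δ s x + θ * (P - Δ s x)
      ≈⟨ +-congˡ (trans (x[y-z]≈xy-xz θ P _) (+-congˡ (-‿distribˡ-* θ _))) ⟩
    x * Δ s x + (θ * P + (- θ) * Δ s x)   ∎
    where
    P = x ^ s
    Q = (x - θ) ^ s
    P-Δ≈Q : P - Δ s x ≈ Q
    P-Δ≈Q = begin
      P - (P - Q)   ≈⟨ +-congˡ (⁻¹-anti-homo‿- P Q) ⟩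
      P + (Q - P)   ≈⟨ +-assoc _ _ _ ⟨
      P + Q - P     ≈⟨ AbelianGroupProperties.xyx⁻¹≈y +-abelianGroup P Q ⟩
      Q             ∎

  -- By the recursion the leading coefficient grows by θ at each step: multiplication by `x` keeps
  -- the old one, and the term θ x^s adds one more.
  Δ-expansion : ∀ n → ∃ λ R → PowerSpan n R × (∀ x → Δ (suc n) x ≈ (suc n · θ) * x ^ n + R x)
  Δ-expansion zero = (λ _ → 0#) , null , λ x → begin
    x * 1# - (x - θ) * 1#   ≈⟨ +-cong (*-identityʳ x) (-‿cong (*-identityʳ (x - θ))) ⟩
    x - (x - θ)             ≈⟨ +-congˡ (⁻¹-anti-homo‿- x θ) ⟩
    x + (θ - x)             ≈⟨ +-assoc _ _ _ ⟨
    x + θ - x               ≈⟨ AbelianGroupProperties.xyx⁻¹≈y +-abelianGroup x θ ⟩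
    θ                       ≈⟨ +-identityʳ _ ⟨
    θ + 0#                  ≈⟨ *-identityʳ _ ⟨
    (θ + 0#) * 1#           ≈⟨ +-identityʳ _ ⟨
    (θ + 0#) * 1# + 0#      ∎
  Δ-expansion (suc n) with Δ-expansion n
  ... | R , spanR , eq =
    -- The new remainder collects the shifted old one and the term `(- θ) * Δ (suc n) x`, which has
    -- degree at most `n`.
    (λ x → x * R x + (- θ) * ((suc n · θ) * x ^ n + R x)) ,
    add (x*-span spanR) (scale (- θ) (add (scale (suc n · θ) (power ℕ.≤-refl)) (weaken spanR))) ,
    λ x → begin
      Δ (suc (suc n)) x
        ≈⟨ Δ-suc (suc n) x ⟩
      x * Δ (suc n) x + (θ * x ^ suc n + (- θ) * Δ (suc n) x)
        ≈⟨ +-cong (*-congˡ (eq x)) (+-congˡ (*-congˡ (eq x))) ⟩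
      x * ((suc n · θ) * x ^ n + R x) + (θ * x ^ suc n + (- θ) * ((suc n · θ) * x ^ n + R x))
        ≈⟨ solve 6 (λ x c p r t w → x :* (c :* p :+ r) :+ (t :* (x :* p) :+ w)
                      := (t :+ c) :* (x :* p) :+ (x :* r :+ w)) refl x (suc n · θ) (x ^ n) (R x) θ _ ⟩
      (θ + suc n · θ) * x ^ suc n + (x * R x + (- θ) * ((suc n · θ) * x ^ n + R x)) ∎

  -- The expansion solved for its leading monomial, with `c` inverting the leading coefficient. Only
  -- lower powers occur in `R`, which prepares a strong induction on `n`.
  power-from-Δ : ∀ {c} n → c * (suc n · θ) ≈ 1# →
    ∃ λ R → PowerSpan n R × (∀ x → c * (Δ (suc n) x + (- 1#) * R x) ≈ x ^ n)
  power-from-Δ {c} n inv with Δ-expansion n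
  ... | R , spanR , eq = R , spanR , λ x → begin
    c * (Δ (suc n) x + (- 1#) * R x)
      ≈⟨ *-congˡ (+-cong (eq x) (-1*x≈-x (R x))) ⟩
    c * ((suc n · θ) * x ^ n + R x - R x)
      ≈⟨ *-congˡ (GroupProperties.//-rightDividesʳ +-group _ _) ⟩
    c * ((suc n · θ) * x ^ n)   ≈⟨ *-assoc _ _ _ ⟨
    (c * (suc n · θ)) * x ^ n   ≈⟨ *-congʳ inv ⟩
    1# * x ^ n                  ≈⟨ *-identityˡ _ ⟩
    x ^ n                       ∎

open import Defs

-- The field ℚ(α) as a ℚ-algebra.

embed-isRingHom : IsRingHom (Polynomials.polynomialRing ℚ-ring) fractionRing embed
embed-isRingHom = record
  { isSemiringHomomorphism = record
    { isNearSemiringHomomorphism = record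
      { +-isMonoidHomomorphism = record
        { isMagmaHomomorphism = record
          { isRelHomomorphism = record { cong = λ p≈q → cross (*-congʳ p≈q) }
          ; homo = λ p q → cross (*-cong (sym (+-cong (*-identityʳ p) (*-identityʳ q))) (*-identityʳ _))
          }
        ; ε-homo = cross refl
        }
      ; *-homo = λ p q → cross (*-congˡ (*-identityʳ _))
      }
    ; 1#-homo = cross refl
    }
  ; -‿homo = λ p → cross refl
  }
  where open ℚ[x]

rational-isRingHom : IsRingHom ℚ-ring fractionRing rational
rational-isRingHom = isRingHomomorphism (CommutativeRing.trans fractionRing)
  (ConstantHom.constant-isRingHom ℚ-ring) embed-isRingHom

open CommutativeRing fractionRing
  hiding (_≈_; _+_; _*_; _-_; -_; 0#; 1#; Carrier; zero)
open Exp commutativeSemiring using (^-congˡ; ^-distrib-*)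
open Mult semiring using (×-comm-*; ×-assoc-*; ×-congʳ)
open Sum semiring using (sum-cong-≋; sum-replicate-zero; ∑-distrib-+; *-distribˡ-sum)
open RingProperties ring using (x[y-z]≈xy-xz; ⁻¹-anti-homo‿-; -‿+-comm)
open SemiringSolver commutativeSemiring using (solve; _:=_; _:+_)
open SetoidReasoning setoid
open Exponential fractionRing rational-isRingHom using (1/n*[n×x]≈x)
open BernoulliDifference fractionRing rational-isRingHom using (bernoulli-power-sum)
open PowerDifferences fractionRing θ

-- The Bernoulli formula for content moments.

α*θ≈1 : α * θ ≈ 1#
α*θ≈1 = inverse-correct α α≉0

-- Since αθ = 1, the contents of a row are α times an arithmetic progression of step 1 starting at
-- `A₀ i`. This is the source of the factor `α ^ r`.
α*content : ∀ i j → α * (j · 1# - i · θ) ≈ content i j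
α*content i j = begin
  α * (j · 1# - i · θ)         ≈⟨ x[y-z]≈xy-xz α _ _ ⟩
  α * (j · 1#) - α * (i · θ)
    ≈⟨ +-cong (trans (×-comm-* j α 1#) (×-congʳ j (*-identityʳ α)))
              (-‿cong (trans (×-comm-* i α θ) (×-congʳ i α*θ≈1))) ⟩
  j · α - i · 1#               ∎

-- The common shape of the Bernoulli sum and, with `f` equal to `Δ s`, of `q s`. It is linear in `f`
-- and kills constants.
rowSum : (ℚ⟨α⟩ → ℚ⟨α⟩) → Partition → ℚ⟨α⟩
rowSum f μ = ∑rows μ (λ i → f (A μ i) - f (A₀ i))

contentMoment≈rowSum : ∀ r μ → contentMoment r μ ≈
  (α ^ r * rational (+ 1 / suc r)) * rowSum (evaluate (bernoulli (suc r))) μ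
contentMoment≈rowSum r μ = sym
  (trans (*-distribˡ-sum {len μ} _ _) (sum-cong-≋ {len μ} (λ i → row≈ (toℕ i))))
  where
  B = evaluate (bernoulli (suc r))
  row≈ : ∀ i → (α ^ r * rational (+ 1 / suc r)) * (B (A μ i) - B (A₀ i))
             ≈ ∑[ j < row μ i ] (content i (toℕ j) ^ r)
  row≈ i = begin
    (α ^ r * rational (+ 1 / suc r)) * (B (A μ i) - B (A₀ i))
      ≈⟨ *-assoc _ _ _ ⟩
    α ^ r * (rational (+ 1 / suc r) * (B (A μ i) - B (A₀ i)))
      -- By definition `A μ i` is `row μ i · 1# + A₀ i`, so the power sum starts at `A₀ i` and has
      -- one term for each box of the row.
      ≈⟨ *-congˡ (bernoulli-power-sum r (row μ i) (A₀ i)) ⟩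
    α ^ r * ∑[ j < row μ i ] ((toℕ j · 1# + A₀ i) ^ r)
      ≈⟨ *-distribˡ-sum {row μ i} _ _ ⟩
    ∑[ j < row μ i ] (α ^ r * (toℕ j · 1# + A₀ i) ^ r)
      ≈⟨ sum-cong-≋ {row μ i} (λ j → trans (sym (^-distrib-* α _ r)) (^-congˡ r (α*content i (toℕ j)))) ⟩
    ∑[ j < row μ i ] (content i (toℕ j) ^ r) ∎

-- Row sums of polynomial functions lie in the algebra of the `q s`.

record InAlgebra (f : ℚ⟨α⟩ → ℚ⟨α⟩) : Set where
  constructor inAlgebra
  field rowSum∈qAlgebra : qAlgebra (rowSum f)
open InAlgebra

InAlgebra-respects : ∀ {f g} → (∀ x → f x ≈ g x) → InAlgebra f → InAlgebra g
InAlgebra-respects f≈g (inAlgebra F) = inAlgebra (respects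
  (λ μ → sum-cong-≋ {len μ} (λ i → +-cong (f≈g _) (-‿cong (f≈g _)))) F)

InAlgebra-const : ∀ a → InAlgebra (λ _ → a)
InAlgebra-const a = inAlgebra (respects
  (λ μ → sym (trans (sum-cong-≋ {len μ} (λ i → -‿inverseʳ a)) (sum-replicate-zero (len μ))))
  (scalar 0#))

InAlgebra-+ : ∀ {f g} → InAlgebra f → InAlgebra g → InAlgebra (λ x → f x + g x)
InAlgebra-+ (inAlgebra F) (inAlgebra G) = inAlgebra (respects
  (λ μ → sym (trans
    (sum-cong-≋ {len μ} (λ i → trans (+-congˡ (sym (-‿+-comm _ _)))
      (solve 4 (λ a b c d → (a :+ b) :+ (c :+ d) := (a :+ c) :+ (b :+ d)) refl _ _ _ _)))
    (∑-distrib-+ {len μ} _ _)))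
  (sum-closed F G))

InAlgebra-scale : ∀ a {f} → InAlgebra f → InAlgebra (λ x → a * f x)
InAlgebra-scale a (inAlgebra F) = inAlgebra (respects
  (λ μ → trans (*-distribˡ-sum {len μ} _ _) (sum-cong-≋ {len μ} (λ i → x[y-z]≈xy-xz a _ _)))
  (product-closed (scalar a) F))

InAlgebra-sum : ∀ {n} (f : Fin n → ℚ⟨α⟩ → ℚ⟨α⟩) →
                (∀ k → InAlgebra (f k)) → InAlgebra (λ x → ∑[ k < n ] f k x)
InAlgebra-sum {zero}  f F = InAlgebra-const 0#
InAlgebra-sum {suc n} f F = InAlgebra-+ (F zero) (InAlgebra-sum (λ k → f (suc k)) (λ k → F (suc k)))

InAlgebra-span : ∀ {n f} → (∀ {k} → k < n → InAlgebra (_^ k)) → PowerSpan n f → InAlgebra f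
InAlgebra-span F (power k<n)      = F k<n
InAlgebra-span F null             = InAlgebra-const 0#
InAlgebra-span F (add p q)        = InAlgebra-+ (InAlgebra-span F p) (InAlgebra-span F q)
InAlgebra-span F (scale a p)      = InAlgebra-scale a (InAlgebra-span F p)
InAlgebra-span F (respects f≈g p) = InAlgebra-respects f≈g (InAlgebra-span F p)

-- Rearranging the four terms in each summand of `q s` gives the row sum of `Δ s`.
InAlgebra-Δ : ∀ s → 2 ≤ s → InAlgebra (Δ s)
InAlgebra-Δ s 2≤s = inAlgebra (respects
  (λ μ → sum-cong-≋ {len μ} (λ i →
    trans (+-assoc _ _ _) (+-congˡ (trans (+-comm _ _) (sym (⁻¹-anti-homo‿- _ _))))))
  (generator (s , 2≤s)))

-- Inverts the leading coefficient nθ of `Δ n`, using that α is the inverse of θ.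
α/n*nθ≈1 : ∀ n .{{_ : ℕ.NonZero n}} → (rational (+ 1 / n) * α) * (n · θ) ≈ 1#
α/n*nθ≈1 n = begin
  (rational (+ 1 / n) * α) * (n · θ)   ≈⟨ *-assoc _ _ _ ⟩
  rational (+ 1 / n) * (α * (n · θ))   ≈⟨ *-congˡ (×-comm-* n α θ) ⟩
  rational (+ 1 / n) * (n · (α * θ))   ≈⟨ 1/n*[n×x]≈x n (α * θ) ⟩
  α * θ                                ≈⟨ α*θ≈1 ⟩
  1#                                   ∎

InAlgebra-power : ∀ n → InAlgebra (_^ n)
InAlgebra-power = <-rec (λ n → InAlgebra (_^ n)) step
  where
  step : ∀ n → (∀ {k} → k < n → InAlgebra (_^ k)) → InAlgebra (_^ n)
  -- The power 0 is a constant. A power n = `suc m` is the leading one of the difference of index n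
  -- + 1, which is at least 2, as a generator requires.
  step zero    _     = InAlgebra-const 1#
  step (suc m) lower =
    let s = suc (suc m)
        c = rational (+ 1 / s) * α
        R , spanR , x^n = power-from-Δ {c} (suc m) (α/n*nθ≈1 s)
    in InAlgebra-respects x^n (InAlgebra-scale c
         (InAlgebra-+ (InAlgebra-Δ s (s≤s (s≤s z≤n)))
                      (InAlgebra-scale (- 1#) (InAlgebra-span lower spanR))))

InAlgebra-evaluate : ∀ p → InAlgebra (evaluate p)
InAlgebra-evaluate p = InAlgebra-sum {bound p} (λ k x → rational (coeff p (toℕ k)) * x ^ toℕ k)
  (λ k → InAlgebra-scale (rational (coeff p (toℕ k))) (InAlgebra-power (toℕ k)))

contentMoment∈qAlgebra : ∀ r → qAlgebra (contentMoment r)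
contentMoment∈qAlgebra r = respects (λ μ → sym (contentMoment≈rowSum r μ))
  (product-closed (scalar (α ^ r * rational (+ 1 / suc r)))
                  (rowSum∈qAlgebra (InAlgebra-evaluate (bernoulli (suc r)))))

proposition6p1 : ((r : ℕ) (μ : Partition) →
    contentMoment r μ ≈
    (α ^ r * rational (+ 1 / suc r)) *
    ∑rows μ (λ i → evaluate (bernoulli (suc r)) (A μ i) - evaluate (bernoulli (suc r)) (A₀ i)))
    × ((r : ℕ) → qAlgebra (contentMoment r))
proposition6p1 = contentMoment≈rowSum , contentMoment∈qAlgebra
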